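{- Let $p$ be a prime and suppose $A\subset\mathbb{F}_p$ with $|A|\leq p^{1/2}$. Then $$|A+A^2|\gtrsim|A|^{147/146},$$ where $A^2=\{a^2 : a \in A \}$ and $A+A^2=\{a+b^2: a,b\in A\}$.
   Context: $X\gtrsim Y$ means $X\ge cY$ for an absolute constant $c>0$. -}

module Defs where

open import Data.Nat using (ℕ; _+_; _*_; NonZero)
open import Data.Nat.DivMod using (_mod_)
open import Data.Nat.Primality using (Prime; prime⇒nonZero)
open import Data.Fin using (Fin; toℕ; _≟_)
open import Data.Fin.Properties using (any?)
open import Data.Fin.Subset using (Subset)
open import Data.Fin.Subset.Properties using (_∈?_)
open import Data.Vec using (tabulate)
open import Relation.Nullary.Decidable using (⌊_⌋; _×-dec_)

-- Elements of 𝔽_p are represented by Fin p (residues 0..p-1);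
-- a subset A ⊆ 𝔽_p is a Subset p.

addSq : (p : ℕ) → .{{NonZero p}} → Fin p → Fin p → Fin p
addSq p a b = (toℕ a + toℕ b * toℕ b) mod p

sumSq : (p : ℕ) → Prime p → Subset p → Subset p
sumSq p pr A = tabulate λ x →
  ⌊ any? (λ a → (a ∈? A) ×-dec any? (λ b → (b ∈? A) ×-dec (x ≟ addSq p {{prime⇒nonZero pr}} a b))) ⌋

{-# OPTIONS --safe #-}
-- Write n = |A|, S = A² and M = |A + S|. Ruzsa's triangle inequality bounds |A - A| by 2M²/n, and
-- Plünnecke's inequality (with Petridis' proof) bounds |12S - 12S| by (M/n)²⁴ n.
--
-- If x is a popular difference of A, then a² - (a - x)² = 2xa - x² for every a in A ∩ (A + x), so a
-- dilate of a large part of A lies in a translate of S - S; covering A by O((M/n)⁴) translates of the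
-- difference set of that part shows that 2xA lies in O((M/n)⁴) translates of 2S - 2S. Averaging
-- gives a₀ in A such that b - a₀ is popular for all b in a set B ⊆ A with |B| ≥ n/2.
--
-- Let R = (B - B)/(B - B). Either some ξ in R has ξ + 1 outside R, and then (c, d) ↦ c + (ξ + 1)d is
-- injective on B × B; or R is the whole field, and since |B|² ≤ p some η makes (c, d) ↦ c + ηd
-- injective up to a factor 2, where η - 1 is in R. In both cases, with ξ = (b₁ - b₂)/(b₃ - b₄), the
-- roughly |B|² values 2(b₃ - b₄)(c + (ξ + 1)d) are signed sums of six elements of the sets
-- 2(bᵢ - a₀)A, hence lie in O((M/n)²⁴) translates of 12S - 12S. So n² = O((M/n)⁴⁸ n), and
-- since M ≥ n the exponent may be weakened from 49/48 to 147/146.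
module Submission where

open import Defs
open import Algebra.Bundles using (AbelianGroup)
open import Algebra.Core using (Op₁; Op₂)
import Algebra.Solver.Ring
open import Algebra.Solver.Ring.AlmostCommutativeRing using (AlmostCommutativeRing; fromCommutativeRing; _-Raw-AlmostCommutative⟶_; Induced-equivalence)
open import Algebra.Structures using (IsAbelianGroup; IsCommutativeRing)
open import Data.Fin using (Fin; zero; suc; toℕ; fromℕ<; _≟_)
open import Data.Fin.Properties using (suc-injective; toℕ-injective; toℕ-fromℕ<; toℕ<n) renaming (any? to anyFin?)
open import Data.Fin.Subset using (Subset; ∣_∣; inside; outside) renaming (_∈_ to _∈ˢ_)
open import Data.Fin.Subset.Properties using () renaming (_∈?_ to _∈ˢ?_)
open import Data.Integer using (ℤ)
import Data.Integer as ℤ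
open import Data.Integer.DivMod using (_%ℕ_; _/ℕ_; n%ℕd<d; a≡a%ℕn+[a/ℕn]*n)
import Data.Integer.Properties as ℤ
open import Data.Integer.Solver using () renaming (module +-*-Solver to ℤSolver)
open import Data.List using (List; []; _∷_; _++_; length; map; filter; concatMap; deduplicate; cartesianProduct; cartesianProductWith; allFin)
open import Data.List.Membership.Propositional using (_∈_; _∉_; find; lose)
open import Data.List.Membership.Propositional.Properties
open import Data.List.Properties using (length-++-sucʳ; length-++; length-map; length-deduplicate; length-tabulate; length-filter)
open import Data.List.Relation.Binary.Subset.Propositional using (_⊆_)
open import Data.List.Relation.Unary.All as All using (All; []; _∷_; all?)
open import Data.List.Relation.Unary.AllPairs using ([]; _∷_)
open import Data.List.Relation.Unary.Any using (Any; here; there; any?)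
open import Data.List.Relation.Unary.Unique.DecPropositional.Properties using (deduplicate-!)
open import Data.List.Relation.Unary.Unique.Propositional using (Unique)
import Data.List.Relation.Unary.Unique.Propositional.Properties as Uniq
open import Data.Maybe using (just; nothing)
open import Data.Nat using (ℕ; zero; suc; _+_; _*_; _^_; _∸_; _⊔_; _≤_; _<_; z≤n; s≤s; NonZero; >-nonZero; >-nonZero⁻¹)
open import Data.Nat.DivMod using (m<n⇒m%n≡m)
import Data.Nat.Divisibility as ℕ
open import Data.Nat.ListAction using (sum)
open import Data.Nat.Primality using (Prime; prime⇒nonZero; euclidsLemma)
open import Data.Nat.Properties hiding (_≟_; suc-injective)
open import Data.Nat.Solver using () renaming (module +-*-Solver to ℕSolver)
open import Data.List.Extrema ≤-totalOrder using (argmin; argmin-all; f[argmin]≤f[⊤]; f[argmin]≤f[xs])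
open import Data.Product using (Σ; ∃; _×_; _,_; proj₁; proj₂; map₁; map₂)
open import Data.Sum using (_⊎_; inj₁; inj₂)
open import Data.Vec using ([]; _∷_; here; there)
open import Data.Vec.Properties using (lookup⇒[]=; lookup∘tabulate)
open import Function using (_∘_; id)
open import Relation.Binary.Definitions using (DecidableEquality; WeaklyDecidable)
open import Relation.Binary.PropositionalEquality using (_≡_; _≢_; refl; sym; trans; cong; cong₂; subst; isEquivalence; module ≡-Reasoning)
open import Relation.Nullary using (¬_; Dec; yes; no; contradiction)
open import Relation.Nullary.Decidable using (_×-dec_; ¬?; ⌊_⌋; isYes≗does; dec-true)
open import Relation.Unary using (Decidable)
open import Relation.Unary.Properties using (∁?)

private
  variable
    X Y Z : Set

-- Counting with lists

-- Pigeonhole by induction on `xs`: the image of the head is deleted from `ys`, and the other images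
-- survive because `R` is injective. A relation, unlike a function, lets the image depend on the
-- proof of membership.
length-inject : {R : X → Y → Set} {xs : List X} {ys : List Y} → Unique xs →
  (∀ {x} → x ∈ xs → ∃ λ y → y ∈ ys × R x y) →
  (∀ {x x' y} → R x y → R x' y → x ≡ x') → length xs ≤ length ys
length-inject {xs = []} _ _ _ = z≤n
length-inject {R = R} {xs = x ∷ xs} (x∉ ∷ u) img inj with img (here refl)
... | y , y∈ , r with ∈-∃++ y∈
... | ys₁ , ys₂ , refl = subst (suc (length xs) ≤_) (sym (length-++-sucʳ ys₁ y ys₂))
                           (s≤s (length-inject u img' inj))
  where
  img' : ∀ {x'} → x' ∈ xs → ∃ λ y' → y' ∈ ys₁ ++ ys₂ × R x' y'
  img' x'∈ with img (there x'∈)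
  ... | y' , y'∈ , r' with ∈-++⁻ ys₁ y'∈
  ...   | inj₁ q = y' , ∈-++⁺ˡ q , r'
  ...   | inj₂ (here refl) = contradiction (inj r r') (All.lookup x∉ x'∈)
  ...   | inj₂ (there q) = y' , ∈-++⁺ʳ ys₁ q , r'

-- A head above `m` leaves the tail with average at most `m`, so the search continues there. The
-- membership excludes the empty list.
average-≤ : (f : X → ℕ) {x₀ : X} {xs : List X} (m : ℕ) → x₀ ∈ xs →
  sum (map f xs) ≤ length xs * m → ∃ λ x → x ∈ xs × f x ≤ m
average-≤ {X} f {xs = x ∷ xs} m _ = go x xs
  where
  go : ∀ x (xs : List X) → sum (map f (x ∷ xs)) ≤ length (x ∷ xs) * m → ∃ λ y → y ∈ x ∷ xs × f y ≤ m
  go x [] h = x , here refl , +-cancelʳ-≤ 0 (f x) m h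
  go x (y ∷ xs) h with f x ≤? m
  ... | yes fx≤m = x , here refl , fx≤m
  ... | no fx≰m = map₂ (map₁ there) (go y xs
                    (+-cancelˡ-≤ m _ _ (≤-trans (+-monoˡ-≤ (sum (map f (y ∷ xs))) (≰⇒≥ fx≰m)) h)))

length-filter-∁ : {P : X → Set} (P? : Decidable P) (xs : List X) →
  length (filter P? xs) + length (filter (∁? P?) xs) ≡ length xs
length-filter-∁ P? [] = refl
length-filter-∁ P? (x ∷ xs) with P? x
... | yes _ = cong suc (length-filter-∁ P? xs)
... | no _  = trans (+-suc _ _) (cong suc (length-filter-∁ P? xs))

length-cartesianProductWith : (f : X → Y → Z) (xs : List X) (ys : List Y) →
  length (cartesianProductWith f xs ys) ≡ length xs * length ys
length-cartesianProductWith f [] ys = refl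
length-cartesianProductWith f (x ∷ xs) ys = trans (length-++ (map (f x) ys))
  (cong₂ _+_ (length-map (f x) ys) (length-cartesianProductWith f xs ys))

sum-≤ : (f : X → ℕ) (xs : List X) (m : ℕ) → (∀ {x} → x ∈ xs → f x ≤ m) →
  sum (map f xs) ≤ length xs * m
sum-≤ f [] m h = z≤n
sum-≤ f (x ∷ xs) m h = +-mono-≤ (h (here refl)) (sum-≤ f xs m (h ∘ there))

sum-*ˡ : (k : ℕ) (f : X → ℕ) (xs : List X) → sum (map (λ x → k * f x) xs) ≡ k * sum (map f xs)
sum-*ˡ k f [] = sym (*-zeroʳ k)
sum-*ˡ k f (x ∷ xs) = trans (cong (k * f x +_) (sum-*ˡ k f xs)) (sym (*-distribˡ-+ k (f x) _))

sum-+ : (f g : X → ℕ) (xs : List X) → sum (map (λ x → f x + g x) xs) ≡ sum (map f xs) + sum (map g xs)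
sum-+ f g [] = refl
sum-+ f g (x ∷ xs) = trans (cong (f x + g x +_) (sum-+ f g xs)) (+-interchange (f x) (g x) _ _)
  where
  +-interchange : ∀ a b c d → (a + b) + (c + d) ≡ (a + c) + (b + d)
  +-interchange a b c d = trans (+-assoc a b _) (trans (cong (a +_) (trans (sym (+-assoc b c d))
    (trans (cong (_+ d) (+-comm b c)) (+-assoc c b d)))) (sym (+-assoc a c _)))

dependentPairs : List X → (X → List Y) → List (X × Y)
dependentPairs xs f = concatMap (λ x → map (x ,_) (f x)) xs

∈-dependentPairs⁺ : ∀ {xs} {f : X → List Y} {x y} → x ∈ xs → y ∈ f x → (x , y) ∈ dependentPairs xs f
∈-dependentPairs⁺ (here refl) y∈ = ∈-++⁺ˡ (∈-map⁺ _ y∈)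
∈-dependentPairs⁺ {f = f} (there {x = z} x∈) y∈ = ∈-++⁺ʳ (map (z ,_) (f z)) (∈-dependentPairs⁺ x∈ y∈)

∈-dependentPairs⁻ : ∀ xs {f : X → List Y} {x y} → (x , y) ∈ dependentPairs xs f → x ∈ xs × y ∈ f x
∈-dependentPairs⁻ (z ∷ xs) {f} q with ∈-++⁻ (map (z ,_) (f z)) q
... | inj₁ q₁ with ∈-map⁻ _ q₁
...   | _ , y∈ , refl = here refl , y∈
∈-dependentPairs⁻ (z ∷ xs) {f} q | inj₂ q₂ with ∈-dependentPairs⁻ xs q₂
...   | x∈ , y∈ = there x∈ , y∈

dependentPairs⁺ : ∀ {xs} {f : X → List Y} → Unique xs → (∀ x → Unique (f x)) → Unique (dependentPairs xs f)
dependentPairs⁺ [] _ = []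
dependentPairs⁺ {xs = x ∷ xs} {f} (x∉ ∷ u) uf =
  Uniq.++⁺ (Uniq.map⁺ (λ where refl → refl) (uf x)) (dependentPairs⁺ u uf) disjoint
  where
  disjoint : ∀ {z} → ¬ (z ∈ map (x ,_) (f x) × z ∈ dependentPairs xs f)
  disjoint (p , q) with ∈-map⁻ _ p
  ... | _ , _ , refl = All.lookup x∉ (proj₁ (∈-dependentPairs⁻ xs q)) refl

length-dependentPairs : ∀ xs (f : X → List Y) → length (dependentPairs xs f) ≡ sum (map (length ∘ f) xs)
length-dependentPairs [] f = refl
length-dependentPairs (x ∷ xs) f = trans (length-++ (map (x ,_) (f x)))
  (cong₂ _+_ (length-map (x ,_) (f x)) (length-dependentPairs xs f))

-- Cardinalities of sets given by lists

module Cardinality {F : Set} (_≟_ : DecidableEquality F) where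

  open import Data.List.Membership.DecPropositional _≟_ using (_∈?_; _∉?_) public

  elems : List F → List F
  elems = deduplicate _≟_

  -- A finite set is any list of its elements, in any order and with repetitions, so sumsets can be
  -- plain lists of sums; repetitions are removed only for counting.
  card : List F → ℕ
  card xs = length (elems xs)

  private
    variable
      xs ys zs : List F

  ∈-elems⁻ : ∀ {x} → x ∈ elems xs → x ∈ xs
  ∈-elems⁻ = ∈-deduplicate⁻ _≟_ _

  ∈-elems⁺ : ∀ {x} → x ∈ xs → x ∈ elems xs
  ∈-elems⁺ = ∈-deduplicate⁺ _≟_

  elems-unique : ∀ xs → Unique (elems xs)
  elems-unique = deduplicate-! _≟_

  unique-⊆⇒length-≤ : Unique xs → xs ⊆ ys → length xs ≤ length ys
  unique-⊆⇒length-≤ u sub = length-inject {R = _≡_} u (λ x∈ → _ , sub x∈ , refl) (λ where refl refl → refl)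

  ⊆⇒card≤length : xs ⊆ ys → card xs ≤ length ys
  ⊆⇒card≤length {xs} sub = unique-⊆⇒length-≤ (elems-unique xs) (sub ∘ ∈-elems⁻)

  card-mono : xs ⊆ ys → card xs ≤ card ys
  card-mono sub = ⊆⇒card≤length (∈-elems⁺ ∘ sub)

  card≤length : ∀ xs → card xs ≤ length xs
  card≤length = length-deduplicate _≟_

  unique⇒length≤card : Unique xs → length xs ≤ card xs
  unique⇒length≤card u = unique-⊆⇒length-≤ u ∈-elems⁺

  card-unique : Unique xs → card xs ≡ length xs
  card-unique {xs} u = ≤-antisym (card≤length xs) (unique⇒length≤card u)

  ∈⇒card>0 : ∀ {x} → x ∈ xs → 1 ≤ card xs
  ∈⇒card>0 {xs} x∈ with elems xs | ∈-elems⁺ x∈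
  ... | _ ∷ _ | _ = s≤s z≤n

  card-++ : ∀ xs ys → card (xs ++ ys) ≤ card xs + card ys
  card-++ xs ys = subst (card (xs ++ ys) ≤_) (length-++ (elems xs)) (⊆⇒card≤length sub)
    where
    sub : xs ++ ys ⊆ elems xs ++ elems ys
    sub q with ∈-++⁻ xs q
    ... | inj₁ q₁ = ∈-++⁺ˡ (∈-elems⁺ q₁)
    ... | inj₂ q₂ = ∈-++⁺ʳ (elems xs) (∈-elems⁺ q₂)

  card-disjoint : xs ⊆ zs → ys ⊆ zs → (∀ {z} → z ∈ xs → z ∉ ys) → card xs + card ys ≤ card zs
  card-disjoint {xs} {zs} {ys} xs⊆ ys⊆ disj = subst (_≤ card zs) (length-++ (elems xs))
    (unique-⊆⇒length-≤ (Uniq.++⁺ (elems-unique xs) (elems-unique ys)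
      (λ where (p , q) → disj (∈-elems⁻ p) (∈-elems⁻ q))) sub)
    where
    sub : elems xs ++ elems ys ⊆ elems zs
    sub q with ∈-++⁻ (elems xs) q
    ... | inj₁ q₁ = ∈-elems⁺ (xs⊆ (∈-elems⁻ q₁))
    ... | inj₂ q₂ = ∈-elems⁺ (ys⊆ (∈-elems⁻ q₂))

  -- A value of `g` determines the value of `f`, so relating the two values of a common point is
  -- injective; no map from one image to the other has to be constructed.
  card-map-≤ : ∀ (f g : X → F) xs → (∀ {x y} → g x ≡ g y → f x ≡ f y) →
    card (map f xs) ≤ card (map g xs)
  card-map-≤ f g xs h = length-inject {R = λ a b → ∃ λ x → a ≡ f x × b ≡ g x}
      (elems-unique (map f xs)) img
      (λ where (x , refl , p) (y , refl , q) → h (trans (sym p) q))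
    where
    img : ∀ {a} → a ∈ elems (map f xs) → ∃ λ b → b ∈ elems (map g xs) × ∃ λ x → a ≡ f x × b ≡ g x
    img a∈ with ∈-map⁻ f (∈-elems⁻ a∈)
    ... | x , x∈ , refl = g x , ∈-elems⁺ (∈-map⁺ g x∈) , x , refl , refl

  card-map≤card : ∀ (f : F → F) xs → card (map f xs) ≤ card xs
  card-map≤card f xs = subst (card (map f xs) ≤_) (length-map f (elems xs))
    (⊆⇒card≤length sub)
    where
    sub : map f xs ⊆ map f (elems xs)
    sub q with ∈-map⁻ f q
    ... | x , x∈ , refl = ∈-map⁺ f (∈-elems⁺ x∈)

  card≤card-map : ∀ {f : F → F} xs → (∀ {x y} → f x ≡ f y → x ≡ y) → card xs ≤ card (map f xs)
  card≤card-map {f} xs inj = ≤-trans (card-mono sub) (card-map-≤ id f xs inj)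
    where
    sub : xs ⊆ map id xs
    sub x∈ = ∈-map⁺ id x∈

  -- Double counting of pairs (value, point). The factor `k` expresses a fractional bound `m / k` on
  -- the fibres within ℕ.
  fibre-bound : (f : X → F) {xs : List X} → Unique xs → ∀ k m →
    (∀ s → k * length (filter (λ x → f x ≟ s) xs) ≤ m) → k * length xs ≤ card (map f xs) * m
  fibre-bound f {xs} u k m bound = begin
    k * length xs
      ≤⟨ *-monoʳ-≤ k (length-inject {R = λ x y → x ≡ proj₂ y} {ys = dependentPairs (elems (map f xs)) fibre} u
           (λ {x₀} x∈ → _ , ∈-dependentPairs⁺ {f = fibre} (∈-elems⁺ (∈-map⁺ f x∈)) (∈-filter⁺ (λ x → f x ≟ f x₀) x∈ refl) , refl)
           (λ where refl refl → refl)) ⟩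
    k * length (dependentPairs (elems (map f xs)) fibre)
      ≡⟨ cong (k *_) (length-dependentPairs (elems (map f xs)) fibre) ⟩
    k * sum (map (length ∘ fibre) (elems (map f xs)))
      ≡⟨ sum-*ˡ k (length ∘ fibre) (elems (map f xs)) ⟨
    sum (map (λ s → k * length (fibre s)) (elems (map f xs)))
      ≤⟨ sum-≤ _ (elems (map f xs)) m (λ {s} _ → bound s) ⟩
    card (map f xs) * m ∎
    where
    open ≤-Reasoning
    fibre : F → List _
    fibre s = filter (λ x → f x ≟ s) xs

-- Additive combinatorics in abelian groups

-- Every subset occurs here, as `filter∈sublists` shows, so minimising over subsets is a finite
-- search.
sublists : List X → List (List X)
sublists [] = [] ∷ []
sublists (x ∷ xs) = sublists xs ++ map (x ∷_) (sublists xs)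

∈-sublists⁻ : ∀ (xs : List X) {ys} → ys ∈ sublists xs → ys ⊆ xs
∈-sublists⁻ [] (here refl) ()
∈-sublists⁻ (x ∷ xs) q y∈ with ∈-++⁻ (sublists xs) q
... | inj₁ q₁ = there (∈-sublists⁻ xs q₁ y∈)
... | inj₂ q₂ with ∈-map⁻ (x ∷_) q₂
∈-sublists⁻ (x ∷ xs) q (here refl) | inj₂ q₂ | _ , zs∈ , refl = here refl
∈-sublists⁻ (x ∷ xs) q (there y∈)  | inj₂ q₂ | _ , zs∈ , refl = there (∈-sublists⁻ xs zs∈ y∈)

filter∈sublists : {P : X → Set} (P? : Decidable P) (xs : List X) → filter P? xs ∈ sublists xs
filter∈sublists P? [] = here refl
filter∈sublists P? (x ∷ xs) with P? x
... | yes _ = ∈-++⁺ʳ (sublists xs) (∈-map⁺ (x ∷_) (filter∈sublists P? xs))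
... | no _  = ∈-++⁺ˡ (filter∈sublists P? xs)

module Sumsets {F : Set} (_≟_ : DecidableEquality F) {_∙_ : Op₂ F} {ε : F} {_⁻¹ : Op₁ F}
  (isAbelianGroup : IsAbelianGroup _≡_ _∙_ ε _⁻¹) where

  open Cardinality _≟_

  private
    abelianGroup : AbelianGroup _ _
    abelianGroup = record { isAbelianGroup = isAbelianGroup }

  open IsAbelianGroup isAbelianGroup using (assoc; comm; identityˡ; identityʳ; inverseˡ; inverseʳ)
  open import Algebra.Properties.AbelianGroup abelianGroup using (⁻¹-∙-comm; ∙-cancelˡ; ∙-cancelʳ; ⁻¹-injective; xyx⁻¹≈y)
  open import Algebra.Properties.CommutativeSemigroup (AbelianGroup.commutativeSemigroup abelianGroup) using (interchange)

  infixl 6 _-_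
  _-_ : Op₂ F
  x - y = x ∙ (y ⁻¹)

  infixl 6 _⊕_ _⊖_
  _⊕_ _⊖_ : List F → List F → List F
  U ⊕ V = cartesianProductWith _∙_ U V
  U ⊖ V = cartesianProductWith _-_ U V

  ∙-minus-cancelˡ : ∀ x u v → (x ∙ u) - (x ∙ v) ≡ u - v
  ∙-minus-cancelˡ x u v = trans (cong ((x ∙ u) ∙_) (sym (⁻¹-∙-comm x v)))
    (trans (interchange x u (x ⁻¹) (v ⁻¹)) (trans (cong (_∙ (u - v)) (inverseʳ x)) (identityˡ _)))

  minus-transpose : ∀ {a t y z} → a - y ≡ t - z → a ≡ t ∙ (y - z)
  minus-transpose {a} {t} {y} {z} eq =
    trans (sym (trans (assoc a (y ⁻¹) y) (trans (cong (a ∙_) (inverseˡ y)) (identityʳ a))))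
    (trans (cong (_∙ y) eq) (trans (assoc t (z ⁻¹) y) (cong (t ∙_) (comm (z ⁻¹) y))))

  minus-injectiveʳ : ∀ u {x y} → u - x ≡ u - y → x ≡ y
  minus-injectiveʳ u eq = ⁻¹-injective (∙-cancelˡ u _ _ eq)

  minus-minus : ∀ b a → b - (b - a) ≡ a
  minus-minus b a = ∙-cancelʳ (b - a) _ _ (trans (trans (assoc b _ _) (trans (cong (b ∙_) (inverseˡ _)) (identityʳ b)))
    (sym (trans (sym (assoc a b _)) (xyx⁻¹≈y a b))))

  ∈-⊕⁺ : ∀ {U V u v} → u ∈ U → v ∈ V → u ∙ v ∈ U ⊕ V
  ∈-⊕⁺ = ∈-cartesianProductWith⁺ _∙_

  ∈-⊖⁺ : ∀ {U V u v} → u ∈ U → v ∈ V → u - v ∈ U ⊖ V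
  ∈-⊖⁺ = ∈-cartesianProductWith⁺ _-_

  ⊕-mono : ∀ {U U' V V'} → U ⊆ U' → V ⊆ V' → U ⊕ V ⊆ U' ⊕ V'
  ⊕-mono {U} {V = V} U⊆ V⊆ q with ∈-cartesianProductWith⁻ _∙_ U V q
  ... | _ , _ , u∈ , v∈ , refl = ∈-⊕⁺ (U⊆ u∈) (V⊆ v∈)

  ⊖-mono : ∀ {U U' V V'} → U ⊆ U' → V ⊆ V' → U ⊖ V ⊆ U' ⊖ V'
  ⊖-mono {U} {V = V} U⊆ V⊆ q with ∈-cartesianProductWith⁻ _-_ U V q
  ... | _ , _ , u∈ , v∈ , refl = ∈-⊖⁺ (U⊆ u∈) (V⊆ v∈)

  ⊕-comm-⊆ : ∀ U V → U ⊕ V ⊆ V ⊕ U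
  ⊕-comm-⊆ U V q with ∈-cartesianProductWith⁻ _∙_ U V q
  ... | u , v , u∈ , v∈ , refl = subst (_∈ V ⊕ U) (comm v u) (∈-⊕⁺ v∈ u∈)

  ⊕-assoc-⊆ : ∀ U V W → U ⊕ (V ⊕ W) ⊆ (U ⊕ V) ⊕ W
  ⊕-assoc-⊆ U V W q with ∈-cartesianProductWith⁻ _∙_ U (V ⊕ W) q
  ... | u , _ , u∈ , q' , refl with ∈-cartesianProductWith⁻ _∙_ V W q'
  ...   | v , w , v∈ , w∈ , refl = subst (_∈ (U ⊕ V) ⊕ W) (assoc u v w) (∈-⊕⁺ (∈-⊕⁺ u∈ v∈) w∈)

  card-⊕-≤ : ∀ U V → card (U ⊕ V) ≤ length U * card V
  card-⊕-≤ U V = subst (card (U ⊕ V) ≤_) (length-cartesianProductWith _∙_ U (elems V))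
    (⊆⇒card≤length {xs = U ⊕ V} (⊕-mono {U = U} {V = V} id ∈-elems⁺))

  -- Ruzsa's injection needs `u` and `v` to depend on `δ` alone, not on a proof that `δ` is a
  -- difference. The pair `(δ , δ)` is a placeholder outside `U ⊖ V`.
  representation : List F → List F → F → F × F
  representation U V δ with δ ∈? (U ⊖ V)
  ... | yes p = let u , v , _ = ∈-cartesianProductWith⁻ _-_ U V p in u , v
  ... | no _  = δ , δ

  representation-spec : ∀ U V {δ} → δ ∈ U ⊖ V → let u , v = representation U V δ in
    u ∈ U × v ∈ V × δ ≡ u - v
  representation-spec U V {δ} δ∈ with δ ∈? (U ⊖ V)
  ... | yes p = let _ , _ , spec = ∈-cartesianProductWith⁻ _-_ U V p in spec
  ... | no ¬p = contradiction δ∈ ¬p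

  -- The map `(w , u - v) ↦ (w + u , w + v)` is injective: subtracting the coordinates recovers
  -- `u - v`, hence the chosen `u`, and then `w`.
  ruzsa-triangle : ∀ W U V → card W * card (U ⊖ V) ≤ card (W ⊕ U) * card (W ⊕ V)
  ruzsa-triangle W U V = begin
    card W * card (U ⊖ V)
      ≡⟨ length-cartesianProductWith _,_ (elems W) (elems (U ⊖ V)) ⟨
    length (cartesianProduct (elems W) (elems (U ⊖ V)))
      ≤⟨ length-inject {R = R} (Uniq.cartesianProduct⁺ (elems-unique W) (elems-unique (U ⊖ V))) img inj ⟩
    length (cartesianProduct (elems (W ⊕ U)) (elems (W ⊕ V)))
      ≡⟨ length-cartesianProductWith _,_ (elems (W ⊕ U)) (elems (W ⊕ V)) ⟩
    card (W ⊕ U) * card (W ⊕ V) ∎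
    where
    open ≤-Reasoning
    R : F × F → F × F → Set
    R (w , δ) (y , z) = let u , v = representation U V δ in δ ≡ u - v × y ≡ w ∙ u × z ≡ w ∙ v

    img : ∀ {a} → a ∈ cartesianProduct (elems W) (elems (U ⊖ V)) →
      ∃ λ b → b ∈ cartesianProduct (elems (W ⊕ U)) (elems (W ⊕ V)) × R a b
    img a∈ with ∈-cartesianProduct⁻ (elems W) (elems (U ⊖ V)) a∈
    ... | w∈ , δ∈ with representation-spec U V (∈-elems⁻ δ∈)
    ...   | u∈ , v∈ , δ≡ = _ , ∈-cartesianProduct⁺ (∈-elems⁺ (∈-⊕⁺ (∈-elems⁻ w∈) u∈))
                                                   (∈-elems⁺ (∈-⊕⁺ (∈-elems⁻ w∈) v∈)) , δ≡ , refl , refl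

    inj : ∀ {a a' b} → R a b → R a' b → a ≡ a'
    inj {w , δ} {w' , δ'} {y , z} (δ≡ , y≡ , z≡) (δ'≡ , y≡' , z≡') with
      trans δ≡ (trans (sym (∙-minus-cancelˡ w _ _)) (trans (cong₂ _-_ (trans (sym y≡) y≡') (trans (sym z≡) z≡'))
        (trans (∙-minus-cancelˡ w' _ _) (sym δ'≡))))
    ... | refl = cong (_, δ) (∙-cancelʳ _ w w' (trans (sym y≡) y≡'))

  -- Greedy choice: T is maximal with the translates t - V pairwise disjoint.
  covering : ∀ {v₀} U V → v₀ ∈ V → ∃ λ T → T ⊆ U × length T * card V ≤ card (T ⊖ V) ×
    (∀ {a} → a ∈ U → ∃ λ t → t ∈ T × ∃ λ y → y ∈ V × ∃ λ z → z ∈ V × a ≡ t ∙ (y - z))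
  covering [] V v₀∈ = [] , (λ ()) , z≤n , λ ()
  covering {v₀} (u ∷ U) V v₀∈ with covering U V v₀∈
  ... | T , T⊆ , small , cov with all? (λ y → (u - y) ∉? (T ⊖ V)) V
  ... | yes disj = u ∷ T , sub , bound , cov'
    where
    sub : u ∷ T ⊆ u ∷ U
    sub (here eq) = here eq
    sub (there q) = there (T⊆ q)

    bound : card V + length T * card V ≤ card ((u ∷ T) ⊖ V)
    bound = ≤-trans (+-mono-≤ (card≤card-map V (minus-injectiveʳ u)) small)
      (card-disjoint (∈-++⁺ˡ) (∈-++⁺ʳ (map (u -_) V)) apart)
      where
      apart : ∀ {w} → w ∈ map (u -_) V → w ∉ T ⊖ V
      apart w∈ with ∈-map⁻ _ w∈
      ... | _ , y∈ , refl = All.lookup disj y∈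

    cov' : ∀ {a} → a ∈ u ∷ U → ∃ λ t → t ∈ u ∷ T × ∃ λ y → y ∈ V × ∃ λ z → z ∈ V × a ≡ t ∙ (y - z)
    cov' (here refl) = u , here refl , v₀ , v₀∈ , v₀ , v₀∈ , minus-transpose refl
    cov' (there a∈) = let t , t∈ , rest = cov a∈ in t , there t∈ , rest
  ... | no ¬disj = T , there ∘ T⊆ , small , cov'
    where
    meeting : ∃ λ y → y ∈ V × (u - y) ∈ T ⊖ V
    meeting = go V ¬disj
      where
      go : ∀ ys → ¬ All (λ y → (u - y) ∉ T ⊖ V) ys → ∃ λ y → y ∈ ys × (u - y) ∈ T ⊖ V
      go [] ¬all = contradiction [] ¬all
      go (y ∷ ys) ¬all with (u - y) ∈? (T ⊖ V)
      ... | yes q = y , here refl , q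
      ... | no ¬q = map₂ (map₁ there) (go ys (¬all ∘ (¬q ∷_)))

    cov' : ∀ {a} → a ∈ u ∷ U → ∃ λ t → t ∈ T × ∃ λ y → y ∈ V × ∃ λ z → z ∈ V × a ≡ t ∙ (y - z)
    cov' (there a∈) = cov a∈
    -- A common element `u - y = t - z` of `u - V` and `T - V` places `u` in `t + V - V`.
    cov' (here refl) with meeting
    ... | y , y∈ , q with ∈-cartesianProductWith⁻ _-_ T V q
    ...   | t , z , t∈ , z∈ , eq = t , t∈ , y , y∈ , z , z∈ , minus-transpose eq

  -- Petridis' minimising set in linear form: with K = |A + S| / |A| fixed, it minimises |Z + S| -
  -- K|Z| rather than the ratio |Z + S| / |Z|. Denominators are cleared and negative terms moved
  -- across. `ratio` says that the minimum is at most the value 0 attained at `A`.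
  record Minimiser (A S : List F) : Set where
    field
      set      : List F
      set⊆     : set ⊆ A
      point    : F
      point∈   : point ∈ set
      ratio    : card A * card (set ⊕ S) ≤ card (A ⊕ S) * card set
      minimal  : ∀ {Z} → Z ⊆ set →
        card A * card (set ⊕ S) + card (A ⊕ S) * card Z ≤ card A * card (Z ⊕ S) + card (A ⊕ S) * card set

  -- The set minimises |A| |Z + S| - |A + S| |Z| over nonempty Z ⊆ A, with
  -- |A + S| |A| added to stay in ℕ.
  minimiser : ∀ {a} A S → a ∈ A → Minimiser A S
  minimiser {a} A S a∈ = record
    { set = W ; set⊆ = proj₁ W-good ; point = proj₁ (proj₂ W-good) ; point∈ = proj₂ (proj₂ W-good)
    ; ratio = ratio ; minimal = minimal }
    where
    n M : ℕ
    n = card A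
    M = card (A ⊕ S)

    weight : List F → ℕ
    weight Z = n * card (Z ⊕ S) + M * (n ∸ card Z)

    Nonempty : List F → Set
    Nonempty Z = 1 ≤ length Z

    candidates : List (List F)
    candidates = filter (λ Z → 1 ≤? length Z) (sublists A)

    W : List F
    -- The default `A` is nonempty and takes part in the comparison, which later yields `ratio`.
    W = argmin weight A candidates

    head∈ : ∀ Z → Nonempty Z → ∃ λ z → z ∈ Z
    head∈ (z ∷ _) _ = z , here refl

    W-good : W ⊆ A × ∃ λ z → z ∈ W
    W-good = argmin-all weight {P = λ Z → Z ⊆ A × ∃ λ z → z ∈ Z} (id , a , a∈) (All.tabulate good)
      where
      good : ∀ {Z} → Z ∈ candidates → Z ⊆ A × ∃ λ z → z ∈ Z
      good {Z} Z∈ with ∈-filter⁻ (λ Z → 1 ≤? length Z) {xs = sublists A} Z∈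
      ... | Z∈' , ne = ∈-sublists⁻ A Z∈' , head∈ Z ne

    -- For subsets of `A` the truncated subtraction in `weight` is exact, so the constant `M * n`
    -- cancels from both sides.
    weight-≤⇒ : ∀ {U V} → U ⊆ A → V ⊆ A → weight U ≤ weight V →
      n * card (U ⊕ S) + M * card V ≤ n * card (V ⊕ S) + M * card U
    weight-≤⇒ {U} {V} U⊆ V⊆ h = +-cancelʳ-≤ (M * n) _ _ (begin
      (u + M * card V) + M * n
        ≡⟨ cong (λ k → (u + M * card V) + M * k) (m∸n+n≡m (card-mono U⊆)) ⟨
      (u + M * card V) + M * (n ∸ card U + card U)
        ≡⟨ lemma u M (card V) (n ∸ card U) (card U) ⟩
      weight U + (M * card U + M * card V)
        ≤⟨ +-monoˡ-≤ _ h ⟩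
      weight V + (M * card U + M * card V)
        ≡⟨ cong (weight V +_) (+-comm (M * card U) (M * card V)) ⟩
      weight V + (M * card V + M * card U)
        ≡⟨ lemma v M (card U) (n ∸ card V) (card V) ⟨
      (v + M * card U) + M * (n ∸ card V + card V)
        ≡⟨ cong (λ k → (v + M * card U) + M * k) (m∸n+n≡m (card-mono V⊆)) ⟩
      (v + M * card U) + M * n ∎)
      where
      open ≤-Reasoning
      open ℕSolver
      u v : ℕ
      u = n * card (U ⊕ S)
      v = n * card (V ⊕ S)
      lemma : ∀ u m c e f → (u + m * c) + m * (e + f) ≡ (u + m * e) + (m * f + m * c)
      lemma = solve 5 (λ u m c e f → (u :+ m :* c) :+ m :* (e :+ f) := (u :+ m :* e) :+ (m :* f :+ m :* c)) refl

    ratio : n * card (W ⊕ S) ≤ M * card W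
    ratio = +-cancelʳ-≤ (M * n) _ _ (≤-trans (weight-≤⇒ (proj₁ W-good) id (f[argmin]≤f[⊤] {f = weight} A candidates))
      (≤-reflexive (trans (+-comm (n * M) _) (cong (M * card W +_) (*-comm n M)))))

    minimal : ∀ {Z} → Z ⊆ W → n * card (W ⊕ S) + M * card Z ≤ n * card (Z ⊕ S) + M * card W
    -- The empty set is not a candidate; its inequality is `ratio`.
    minimal {[]} _ = begin
      n * card (W ⊕ S) + M * 0 ≡⟨ cong (n * card (W ⊕ S) +_) (*-zeroʳ M) ⟩
      n * card (W ⊕ S) + 0     ≡⟨ +-identityʳ _ ⟩
      n * card (W ⊕ S)         ≤⟨ ratio ⟩
      M * card W               ≤⟨ m≤n+m _ _ ⟩
      n * 0 + M * card W       ∎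
      where open ≤-Reasoning
    -- `Z` is an arbitrary list, so it competes through `Z'`, the sublist of `A` with the same
    -- elements.
    minimal {Z@(z ∷ _)} Z⊆ = begin
      n * card (W ⊕ S) + M * card Z  ≤⟨ +-monoʳ-≤ _ (*-monoʳ-≤ M (card-mono Z⊆Z')) ⟩
      n * card (W ⊕ S) + M * card Z' ≤⟨ weight-≤⇒ (proj₁ W-good) Z'⊆A (All.lookup (f[argmin]≤f[xs] {f = weight} A candidates) Z'∈) ⟩
      n * card (Z' ⊕ S) + M * card W ≤⟨ +-monoˡ-≤ _ (*-monoʳ-≤ n (card-mono (⊕-mono {V = S} Z'⊆Z id))) ⟩
      n * card (Z ⊕ S) + M * card W  ∎
      where
      open ≤-Reasoning
      Z' : List F
      Z' = filter (_∈? Z) A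
      Z⊆Z' : Z ⊆ Z'
      Z⊆Z' q = ∈-filter⁺ (_∈? Z) (proj₁ W-good (Z⊆ q)) q
      Z'⊆Z : Z' ⊆ Z
      Z'⊆Z q = proj₂ (∈-filter⁻ (_∈? Z) {xs = A} q)
      Z'⊆A : Z' ⊆ A
      Z'⊆A q = proj₁ (∈-filter⁻ (_∈? Z) {xs = A} q)
      nonempty : ∀ {Y : List F} {y} → y ∈ Y → Nonempty Y
      nonempty (here _)  = s≤s z≤n
      nonempty (there _) = s≤s z≤n
      Z'∈ : Z' ∈ candidates
      Z'∈ = ∈-filter⁺ (λ Z → 1 ≤? length Z) (filter∈sublists (_∈? Z) A) (nonempty (Z⊆Z' (here refl)))

  module _ {A S : List F} (W : Minimiser A S) where

    open Minimiser W

    -- Induction on `C`, writing X for `set` and K for |A + S| / |A|. Let Q be the `x` in X with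
    -- `c + x + S` already inside `C + X + S`. Adding `c` enlarges `C + X + S` by at most |X + S| -
    -- |Q + S|, which minimality bounds by K(|X| - |Q|). It enlarges `C + X` by at least |X| - |Q|,
    -- since `c + x` in `C + X` puts `x` into Q.
    petridis : ∀ C → card A * card ((set ⊕ S) ⊕ C) ≤ card (A ⊕ S) * card (set ⊕ C)
    petridis C = ≤-trans (*-monoʳ-≤ (card A) (card-mono (⊕-comm-⊆ (set ⊕ S) C)))
                (≤-trans (go C) (*-monoʳ-≤ (card (A ⊕ S)) (card-mono (⊕-comm-⊆ C set))))
      where
      n M : ℕ
      n = card A
      M = card (A ⊕ S)

      go : ∀ C → n * card (C ⊕ (set ⊕ S)) ≤ M * card (C ⊕ set)
      go [] = subst (_≤ M * 0) (sym (*-zeroʳ n)) z≤n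
      go (c ∷ C) = +-cancelʳ-≤ (n * card (Q ⊕ S) + M * card Q) _ _ (begin
        n * card ((c ∷ C) ⊕ (set ⊕ S)) + (n * card (Q ⊕ S) + M * card Q)
          ≡⟨ lemma₁ n _ _ _ ⟩
        n * (card ((c ∷ C) ⊕ (set ⊕ S)) + card (Q ⊕ S)) + M * card Q
          ≤⟨ +-monoˡ-≤ _ (*-monoʳ-≤ n upper) ⟩
        n * (card (C ⊕ (set ⊕ S)) + card (set ⊕ S)) + M * card Q
          ≡⟨ lemma₂ n _ _ _ ⟩
        n * card (C ⊕ (set ⊕ S)) + (n * card (set ⊕ S) + M * card Q)
          ≤⟨ +-mono-≤ (go C) (minimal (proj₁ ∘ ∈-filter⁻ Q? {xs = set})) ⟩
        M * card (C ⊕ set) + (n * card (Q ⊕ S) + M * card set)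
          ≡⟨ lemma₃ M _ _ _ ⟩
        M * (card (C ⊕ set) + card set) + n * card (Q ⊕ S)
          ≤⟨ +-monoˡ-≤ _ (*-monoʳ-≤ M lower) ⟩
        M * (card ((c ∷ C) ⊕ set) + card Q) + n * card (Q ⊕ S)
          ≡⟨ lemma₄ M _ _ _ ⟩
        M * card ((c ∷ C) ⊕ set) + (n * card (Q ⊕ S) + M * card Q) ∎)
        where
        open ≤-Reasoning
        open ℕSolver
        lemma₁ : ∀ n a b c → n * a + (n * b + c) ≡ n * (a + b) + c
        lemma₁ = solve 4 (λ n a b c → n :* a :+ (n :* b :+ c) := n :* (a :+ b) :+ c) refl
        lemma₂ : ∀ n a b c → n * (a + b) + c ≡ n * a + (n * b + c)
        lemma₂ n a b c = sym (lemma₁ n a b c)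
        lemma₃ : ∀ m a b c → m * a + (b + m * c) ≡ m * (a + c) + b
        lemma₃ = solve 4 (λ m a b c → m :* a :+ (b :+ m :* c) := m :* (a :+ c) :+ b) refl
        lemma₄ : ∀ m a b c → m * (a + c) + b ≡ m * a + (b + m * c)
        lemma₄ m a b c = sym (lemma₃ m a b c)

        Q? : Decidable (λ x → All (λ s → (c ∙ (x ∙ s)) ∈ C ⊕ (set ⊕ S)) S)
        Q? x = all? (λ s → (c ∙ (x ∙ s)) ∈? (C ⊕ (set ⊕ S))) S

        Q : List F
        Q = filter Q? set

        upper : card ((c ∷ C) ⊕ (set ⊕ S)) + card (Q ⊕ S) ≤ card (C ⊕ (set ⊕ S)) + card (set ⊕ S)
        upper = begin
          card ((c ∷ C) ⊕ (set ⊕ S)) + card (Q ⊕ S)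
            ≤⟨ +-monoˡ-≤ _ (≤-trans (card-mono sub) (card-++ (C ⊕ (set ⊕ S)) (map (c ∙_) new))) ⟩
          (card (C ⊕ (set ⊕ S)) + card (map (c ∙_) new)) + card (Q ⊕ S)
            ≤⟨ +-monoˡ-≤ _ (+-monoʳ-≤ (card (C ⊕ (set ⊕ S))) (card-map≤card (c ∙_) new)) ⟩
          (card (C ⊕ (set ⊕ S)) + card new) + card (Q ⊕ S)
            ≡⟨ +-assoc (card (C ⊕ (set ⊕ S))) _ _ ⟩
          card (C ⊕ (set ⊕ S)) + (card new + card (Q ⊕ S))
            ≤⟨ +-monoʳ-≤ (card (C ⊕ (set ⊕ S))) (card-disjoint
                 (proj₁ ∘ ∈-filter⁻ (_∉? (Q ⊕ S)) {xs = set ⊕ S})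
                 (⊕-mono {V = S} (proj₁ ∘ ∈-filter⁻ Q? {xs = set}) id)
                 (proj₂ ∘ ∈-filter⁻ (_∉? (Q ⊕ S)) {xs = set ⊕ S})) ⟩
          card (C ⊕ (set ⊕ S)) + card (set ⊕ S) ∎
          where
          new : List F
          new = filter (_∉? (Q ⊕ S)) (set ⊕ S)

          sub : (c ∷ C) ⊕ (set ⊕ S) ⊆ C ⊕ (set ⊕ S) ++ map (c ∙_) new
          sub q with ∈-++⁻ (map (c ∙_) (set ⊕ S)) q
          ... | inj₂ q₂ = ∈-++⁺ˡ q₂
          ... | inj₁ q₁ with ∈-map⁻ (c ∙_) q₁
          ...   | w , w∈ , refl with w ∈? (Q ⊕ S)
          ...     | no ¬q = ∈-++⁺ʳ (C ⊕ (set ⊕ S)) (∈-map⁺ (c ∙_) (∈-filter⁺ (_∉? (Q ⊕ S)) w∈ ¬q))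
          ...     | yes w∈' with ∈-cartesianProductWith⁻ _∙_ Q S w∈'
          ...       | x , s , x∈ , s∈ , refl = ∈-++⁺ˡ (All.lookup (proj₂ (∈-filter⁻ Q? {xs = set} x∈)) s∈)

        lower : card (C ⊕ set) + card set ≤ card ((c ∷ C) ⊕ set) + card Q
        lower = begin
          card (C ⊕ set) + card set
            ≤⟨ +-monoʳ-≤ (card (C ⊕ set)) (≤-trans (card-mono split) (card-++ fresh Q)) ⟩
          card (C ⊕ set) + (card fresh + card Q)
            ≤⟨ +-monoʳ-≤ (card (C ⊕ set)) (+-monoˡ-≤ _ (card≤card-map fresh (∙-cancelˡ c _ _))) ⟩
          card (C ⊕ set) + (card (map (c ∙_) fresh) + card Q)
            ≡⟨ +-assoc (card (C ⊕ set)) _ _ ⟨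
          (card (C ⊕ set) + card (map (c ∙_) fresh)) + card Q
            ≤⟨ +-monoˡ-≤ (card Q) (card-disjoint (∈-++⁺ʳ (map (c ∙_) set)) fresh⊆ disj) ⟩
          card ((c ∷ C) ⊕ set) + card Q ∎
          where
          fresh? : Decidable (λ x → (c ∙ x) ∉ C ⊕ set)
          fresh? x = (c ∙ x) ∉? (C ⊕ set)

          fresh : List F
          fresh = filter fresh? set

          split : set ⊆ fresh ++ Q
          split {x} x∈ with (c ∙ x) ∈? (C ⊕ set)
          ... | no ¬q = ∈-++⁺ˡ (∈-filter⁺ fresh? x∈ ¬q)
          ... | yes q = ∈-++⁺ʳ fresh (∈-filter⁺ Q? x∈ (All.tabulate absorbed))
            where
            absorbed : ∀ {s} → s ∈ S → (c ∙ (x ∙ s)) ∈ C ⊕ (set ⊕ S)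
            absorbed {s} s∈ with ∈-cartesianProductWith⁻ _∙_ C set q
            ... | c' , x' , c'∈ , x'∈ , eq = subst (_∈ C ⊕ (set ⊕ S))
              (trans (sym (assoc c' x' s)) (trans (cong (_∙ s) (sym eq)) (assoc c x s)))
              (∈-⊕⁺ c'∈ (∈-⊕⁺ x'∈ s∈))

          fresh⊆ : map (c ∙_) fresh ⊆ (c ∷ C) ⊕ set
          fresh⊆ q with ∈-map⁻ (c ∙_) q
          ... | x , x∈ , refl = ∈-++⁺ˡ (∈-map⁺ (c ∙_) (proj₁ (∈-filter⁻ fresh? {xs = set} x∈)))

          disj : ∀ {z} → z ∈ C ⊕ set → z ∉ map (c ∙_) fresh
          disj z∈ q with ∈-map⁻ (c ∙_) q
          ... | x , x∈ , refl = proj₂ (∈-filter⁻ fresh? {xs = set} x∈) z∈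

  abstract

    -- The `k`-fold sumset of `S`, not its dilate by `k`.
    _⊗_ : ℕ → List F → List F
    zero ⊗ S = ε ∷ []
    suc k ⊗ S = S ⊕ (k ⊗ S)

    ∈-⊗-+ : ∀ k {l S u v} → u ∈ k ⊗ S → v ∈ l ⊗ S → u ∙ v ∈ (k + l) ⊗ S
    ∈-⊗-+ zero {l} {S} {v = v} (here refl) v∈ = subst (_∈ l ⊗ S) (sym (identityˡ v)) v∈
    ∈-⊗-+ (suc k) {l} {S} {v = v} u∈ v∈ with ∈-cartesianProductWith⁻ _∙_ S (k ⊗ S) u∈
    ... | s , w , s∈ , w∈ , refl = subst (_∈ suc (k + l) ⊗ S) (sym (assoc s w v)) (∈-⊕⁺ s∈ (∈-⊗-+ k w∈ v∈))

    ∈-1⊗ : ∀ {S s} → s ∈ S → s ∈ 1 ⊗ S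
    ∈-1⊗ {S} {s} s∈ = subst (_∈ 1 ⊗ S) (identityʳ s) (∈-⊕⁺ s∈ (here refl))

    -- Each use of `petridis`, with the remaining sumset as C, removes one summand `S` at the cost
    -- of a factor |A + S| / |A|; the same minimiser serves all `k`.
    plünnecke⁺ : ∀ {A S} (W : Minimiser A S) k → let open Minimiser W in
      card A ^ k * card (set ⊕ (k ⊗ S)) ≤ card (A ⊕ S) ^ k * card set
    plünnecke⁺ {A} {S} W zero = *-monoʳ-≤ 1 (card-mono sub)
      where
      open Minimiser W
      sub : set ⊕ (ε ∷ []) ⊆ set
      sub q with ∈-cartesianProductWith⁻ _∙_ set (ε ∷ []) q
      ... | x , _ , x∈ , here refl , refl = subst (_∈ set) (sym (identityʳ x)) x∈
    plünnecke⁺ {A} {S} W (suc k) = begin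
      n * n ^ k * card (set ⊕ (S ⊕ (k ⊗ S)))
        ≤⟨ *-monoʳ-≤ (n * n ^ k) (card-mono (⊕-assoc-⊆ set S (k ⊗ S))) ⟩
      n * n ^ k * card ((set ⊕ S) ⊕ (k ⊗ S))
        ≡⟨ trans (cong (_* card ((set ⊕ S) ⊕ (k ⊗ S))) (*-comm n (n ^ k))) (*-assoc (n ^ k) n _) ⟩
      n ^ k * (n * card ((set ⊕ S) ⊕ (k ⊗ S)))
        ≤⟨ *-monoʳ-≤ (n ^ k) (petridis W (k ⊗ S)) ⟩
      n ^ k * (M * card (set ⊕ (k ⊗ S)))
        ≡⟨ trans (sym (*-assoc (n ^ k) M _)) (trans (cong (_* card (set ⊕ (k ⊗ S))) (*-comm (n ^ k) M)) (*-assoc M (n ^ k) _)) ⟩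
      M * (n ^ k * card (set ⊕ (k ⊗ S)))
        ≤⟨ *-monoʳ-≤ M (plünnecke⁺ W k) ⟩
      M * (M ^ k * card set)
        ≡⟨ *-assoc M (M ^ k) _ ⟨
      M * M ^ k * card set ∎
      where
      open ≤-Reasoning
      open Minimiser W
      n M : ℕ
      n = card A
      M = card (A ⊕ S)

  -- Ruzsa's triangle inequality through the minimiser X gives |X| |kS - kS| ≤ |X + kS|², and
  -- `plünnecke⁺` bounds the right side; one factor |X| cancels and the other is at most |A|.
  plünnecke : ∀ {a} A S k → a ∈ A →
    (card A ^ k * card A ^ k) * card ((k ⊗ S) ⊖ (k ⊗ S)) ≤ (card (A ⊕ S) ^ k * card (A ⊕ S) ^ k) * card A
  plünnecke A S k a∈ = *-cancelˡ-≤ (card set) {{>-nonZero (∈⇒card>0 point∈)}} (begin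
    w * ((nᵏ * nᵏ) * D)       ≡⟨ lemma₁ w nᵏ D ⟩
    (nᵏ * nᵏ) * (w * D)       ≤⟨ *-monoʳ-≤ (nᵏ * nᵏ) (ruzsa-triangle set (k ⊗ S) (k ⊗ S)) ⟩
    (nᵏ * nᵏ) * (G * G)       ≡⟨ lemma₂ nᵏ G ⟩
    (nᵏ * G) * (nᵏ * G)       ≤⟨ *-mono-≤ (plünnecke⁺ W k) (plünnecke⁺ W k) ⟩
    (Mᵏ * w) * (Mᵏ * w)       ≡⟨ lemma₃ Mᵏ w ⟩
    w * ((Mᵏ * Mᵏ) * w)       ≤⟨ *-monoʳ-≤ w (*-monoʳ-≤ (Mᵏ * Mᵏ) (card-mono set⊆)) ⟩
    w * ((Mᵏ * Mᵏ) * card A)  ∎)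
    where
    open ≤-Reasoning
    open ℕSolver
    W : Minimiser A S
    W = minimiser A S a∈
    open Minimiser W
    w nᵏ Mᵏ D G : ℕ
    w = card set
    nᵏ = card A ^ k
    Mᵏ = card (A ⊕ S) ^ k
    D = card ((k ⊗ S) ⊖ (k ⊗ S))
    G = card (set ⊕ (k ⊗ S))
    lemma₁ : ∀ w n d → w * ((n * n) * d) ≡ (n * n) * (w * d)
    lemma₁ = solve 3 (λ w n d → w :* ((n :* n) :* d) := (n :* n) :* (w :* d)) refl
    lemma₂ : ∀ n g → (n * n) * (g * g) ≡ (n * g) * (n * g)
    lemma₂ = solve 2 (λ n g → (n :* n) :* (g :* g) := (n :* g) :* (n :* g)) refl
    lemma₃ : ∀ m w → (m * w) * (m * w) ≡ w * ((m * m) * w)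
    lemma₃ = solve 2 (λ m w → (m :* w) :* (m :* w) := w :* ((m :* m) :* w)) refl

  -- A ∩ (A + x)
  overlapOf : List F → F → List F
  overlapOf A x = filter (λ a → (a - x) ∈? A) A

  -- The threshold is half of |A|² / |A - A|, the average number of representations of a difference.
  Popular : List F → F → Set
  Popular A x = length A * length A ≤ 2 * card (A ⊖ A) * length (overlapOf A x)

  popular? : ∀ A → Decidable (Popular A)
  popular? A x = length A * length A ≤? 2 * card (A ⊖ A) * length (overlapOf A x)

  popularFrom : List F → F → List F
  popularFrom A a₀ = filter (λ b → popular? A (b - a₀)) A

  -- The unpopular differences are at most |A - A| many, so they account for at
  -- most half of all pairs.
  exists-popularFrom : ∀ {a A} → Unique A → a ∈ A → ∃ λ a₀ → a₀ ∈ A × length A ≤ 2 * length (popularFrom A a₀)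
  exists-popularFrom {a} {A} u a∈ =
    let a₀ , a₀∈ , h = average-≤ (λ a₀ → 2 * length (rest a₀)) n a∈ total in
    a₀ , a₀∈ , half (popularFrom A a₀) (rest a₀) (length-filter-∁ (λ b → popular? A (b - a₀)) A) h
    where
    open ≤-Reasoning
    open ℕSolver
    n d : ℕ
    n = length A
    d = card (A ⊖ A)

    rest : F → List F
    rest a₀ = filter (∁? (λ b → popular? A (b - a₀))) A

    half : ∀ (P Q : List F) → length P + length Q ≡ n → 2 * length Q ≤ n → n ≤ 2 * length P
    half P Q eq h = +-cancelʳ-≤ n _ _ (begin
      n + n                     ≡⟨ cong (n +_) (+-identityʳ n) ⟨
      2 * n                     ≡⟨ cong (2 *_) eq ⟨
      2 * (length P + length Q) ≡⟨ *-distribˡ-+ 2 (length P) (length Q) ⟩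
      2 * length P + 2 * length Q ≤⟨ +-monoʳ-≤ (2 * length P) h ⟩
      2 * length P + n          ∎)

    pairs : List (F × F)
    pairs = dependentPairs A rest

    pairs-unique : Unique pairs
    pairs-unique = dependentPairs⁺ u (λ a₀ → Uniq.filter⁺ (∁? (λ b → popular? A (b - a₀))) u)

    difference : F × F → F
    difference (a₀ , b) = b - a₀

    fibre-≤ : ∀ s → 2 * d * length (filter (λ q → difference q ≟ s) pairs) ≤ n * n
    fibre-≤ s with popular? A s
    -- For unpopular `s`, a pair in the fibre is determined by `b`, which lies in `overlapOf A s`.
    -- For popular `s` the fibre is empty, by the definition of `rest`.
    ... | no ¬pop = ≤-trans (*-monoʳ-≤ (2 * d) (length-inject {R = λ q b → proj₂ q ≡ b × difference q ≡ s}
            (Uniq.filter⁺ (λ q → difference q ≟ s) pairs-unique) img inj)) (≰⇒≥ ¬pop)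
      where
      img : ∀ {q} → q ∈ filter (λ q → difference q ≟ s) pairs →
        ∃ λ b → b ∈ overlapOf A s × proj₂ q ≡ b × difference q ≡ s
      img {a₀ , b} q∈ with ∈-filter⁻ (λ q → difference q ≟ s) {xs = pairs} q∈
      ... | q∈' , refl with ∈-dependentPairs⁻ A q∈'
      ...   | a₀∈ , b∈ = b , ∈-filter⁺ (λ a → (a - s) ∈? A) (proj₁ (∈-filter⁻ (∁? (λ b → popular? A (b - a₀))) {xs = A} b∈))
                               (subst (_∈ A) (sym (minus-minus b a₀)) a₀∈) , refl , refl
      inj : ∀ {q q' b} → proj₂ q ≡ b × difference q ≡ s → proj₂ q' ≡ b × difference q' ≡ s → q ≡ q'
      inj {_ , b} (refl , e) (refl , e') = cong (_, b) (minus-injectiveʳ b (trans e (sym e')))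
    ... | yes pop with filter (λ q → difference q ≟ s) pairs in eq
    ...   | [] = subst (_≤ n * n) (sym (*-zeroʳ (2 * d))) z≤n
    ...   | (a₀ , b) ∷ _ with ∈-filter⁻ (λ q → difference q ≟ s) {xs = pairs} (subst ((a₀ , b) ∈_) (sym eq) (here refl))
    ...     | q∈ , refl = contradiction pop (proj₂ (∈-filter⁻ (∁? (λ b → popular? A (b - a₀))) {xs = A} (proj₂ (∈-dependentPairs⁻ A q∈))))

    pairs-≤ : 2 * length pairs ≤ n * n
    pairs-≤ = *-cancelˡ-≤ d {{>-nonZero (∈⇒card>0 (∈-⊖⁺ a∈ a∈))}} (begin
      d * (2 * length pairs)         ≡⟨ solve 2 (λ d l → d :* (con 2 :* l) := con 2 :* d :* l) refl d (length pairs) ⟩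
      2 * d * length pairs           ≤⟨ fibre-bound difference pairs-unique (2 * d) (n * n) fibre-≤ ⟩
      card (map difference pairs) * (n * n) ≤⟨ *-monoˡ-≤ (n * n) (card-mono sub) ⟩
      d * (n * n)                    ∎)
      where
      sub : map difference pairs ⊆ A ⊖ A
      sub q with ∈-map⁻ difference q
      ... | (a₀ , b) , q∈ , refl with ∈-dependentPairs⁻ A q∈
      ...   | a₀∈ , b∈ = ∈-⊖⁺ (proj₁ (∈-filter⁻ (∁? (λ b → popular? A (b - a₀))) {xs = A} b∈)) a₀∈

    total : sum (map (λ a₀ → 2 * length (rest a₀)) A) ≤ n * n
    total = begin
      sum (map (λ a₀ → 2 * length (rest a₀)) A) ≡⟨ sum-*ˡ 2 (length ∘ rest) A ⟩
      2 * sum (map (length ∘ rest) A)           ≡⟨ cong (2 *_) (length-dependentPairs A rest) ⟨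
      2 * length pairs                          ≤⟨ pairs-≤ ⟩
      n * n                                     ∎

-- The prime field

module PrimeField (p : ℕ) (pr : Prime p) where

  open import Data.Integer using (+_)
  open import Data.Integer.Divisibility.Signed using (_∣_; divides; ∣⇒∣ᵤ; ∣ᵤ⇒∣)

  private instance
    p-nonZero : NonZero p
    p-nonZero = prime⇒nonZero pr

  𝔽 : Set
  𝔽 = Fin p

  open import Algebra.Definitions (_≡_ {A = 𝔽})

  infixl 6 _+ᶠ_
  infixl 7 _*ᶠ_
  infix 8 -ᶠ_

  abstract

    -- The field operations reduce the results of integer operations on representatives, so every
    -- ring law is inherited from ℤ.
    ι : ℤ → 𝔽
    ι z = fromℕ< (n%ℕd<d z p)

    ρ : 𝔽 → ℤ
    ρ x = + toℕ x

    _+ᶠ_ _*ᶠ_ : Op₂ 𝔽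
    x +ᶠ y = ι (ρ x ℤ.+ ρ y)
    x *ᶠ y = ι (ρ x ℤ.* ρ y)

    -ᶠ_ : Op₁ 𝔽
    -ᶠ x = ι (ℤ.- ρ x)

    0# 1# : 𝔽
    0# = ι (+ 0)
    1# = ι (+ 1)

    ι-ρ : ∀ x → ι (ρ x) ≡ x
    ι-ρ x = toℕ-injective (trans (toℕ-fromℕ< _) (m<n⇒m%n≡m (toℕ<n x)))

    -- The absolute value of `r - s` is at most the larger of the two, hence below `p`, and the only
    -- multiple of `p` that small is 0.
    remainder-unique : ∀ {r s} → r < p → s < p → + p ∣ + r ℤ.- + s → r ≡ s
    remainder-unique {r} {s} r<p s<p p∣ with ℤ.∣ + r ℤ.- + s ∣ in eq | ∣⇒∣ᵤ p∣
    ... | zero  | _  = ℤ.+-injective (ℤ.i-j≡0⇒i≡j (+ r) (+ s) (ℤ.∣i∣≡0⇒i≡0 eq))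
    ... | suc k | p∣′ = contradiction (ℕ.∣⇒≤ p∣′) (<⇒≱ (subst (_< p) eq small))
      where
      small : ℤ.∣ + r ℤ.- + s ∣ < p
      small = ≤-<-trans (subst (λ z → ℤ.∣ z ∣ ≤ r ⊔ s) (sym (ℤ.m-n≡m⊖n r s)) (ℤ.∣m⊝n∣≤m⊔n r s)) (⊔-lub r<p s<p)

    p∣ρι : ∀ z → + p ∣ z ℤ.- ρ (ι z)
    p∣ρι z = divides (z /ℕ p) (begin
      z ℤ.- ρ (ι z)                                     ≡⟨ cong (λ r → z ℤ.- + r) (toℕ-fromℕ< (n%ℕd<d z p)) ⟩
      z ℤ.- + (z %ℕ p)                                  ≡⟨ cong (ℤ._- + (z %ℕ p)) (a≡a%ℕn+[a/ℕn]*n z p) ⟩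
      (+ (z %ℕ p) ℤ.+ (z /ℕ p) ℤ.* + p) ℤ.- + (z %ℕ p)  ≡⟨ solve 2 (λ r q → (r :+ q) :- r := q) refl (+ (z %ℕ p)) _ ⟩
      (z /ℕ p) ℤ.* + p                                  ∎)
      where
      open ≡-Reasoning
      open ℤSolver

    ι-cong : ∀ x y → + p ∣ x ℤ.- y → ι x ≡ ι y
    ι-cong x y (divides q eq) with p∣ρι x | p∣ρι y
    ... | divides q₁ e₁ | divides q₂ e₂ = toℕ-injective (remainder-unique (toℕ<n (ι x)) (toℕ<n (ι y))
        (divides (q ℤ.- q₁ ℤ.+ q₂) (begin
          ρ (ι x) ℤ.- ρ (ι y)
            ≡⟨ solve 4 (λ x y r s → r :- s := (x :- y) :- (x :- r) :+ (y :- s)) refl x y (ρ (ι x)) (ρ (ι y)) ⟩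
          (x ℤ.- y) ℤ.- (x ℤ.- ρ (ι x)) ℤ.+ (y ℤ.- ρ (ι y))
            ≡⟨ cong₂ ℤ._+_ (cong₂ ℤ._-_ eq e₁) e₂ ⟩
          q ℤ.* + p ℤ.- q₁ ℤ.* + p ℤ.+ q₂ ℤ.* + p
            ≡⟨ solve 4 (λ a b c p → a :* p :- b :* p :+ c :* p := (a :- b :+ c) :* p) refl q q₁ q₂ (+ p) ⟩
          (q ℤ.- q₁ ℤ.+ q₂) ℤ.* + p ∎)))
      where
      open ≡-Reasoning
      open ℤSolver

    ι≡0⇒∣ : ∀ z → ι z ≡ 0# → + p ∣ z
    ι≡0⇒∣ z eq with p∣ρι z
    ... | divides q e = divides q (trans (sym (ℤ.+-identityʳ z)) (trans (cong (λ r → z ℤ.- + r) (sym ρ≡0)) e))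
      where
      ρ≡0 : toℕ (ι z) ≡ 0
      ρ≡0 = trans (cong toℕ eq) (trans (toℕ-fromℕ< _) (m<n⇒m%n≡m (>-nonZero⁻¹ p)))

    +-homo : ∀ x y → ι (x ℤ.+ y) ≡ ι x +ᶠ ι y
    +-homo x y with p∣ρι x | p∣ρι y
    ... | divides q₁ e₁ | divides q₂ e₂ = ι-cong (x ℤ.+ y) (ρ (ι x) ℤ.+ ρ (ι y)) (divides (q₁ ℤ.+ q₂) (begin
        (x ℤ.+ y) ℤ.- (ρ (ι x) ℤ.+ ρ (ι y))
          ≡⟨ solve 4 (λ x y r s → (x :+ y) :- (r :+ s) := (x :- r) :+ (y :- s)) refl x y (ρ (ι x)) (ρ (ι y)) ⟩
        (x ℤ.- ρ (ι x)) ℤ.+ (y ℤ.- ρ (ι y))   ≡⟨ cong₂ ℤ._+_ e₁ e₂ ⟩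
        q₁ ℤ.* + p ℤ.+ q₂ ℤ.* + p             ≡⟨ ℤ.*-distribʳ-+ (+ p) q₁ q₂ ⟨
        (q₁ ℤ.+ q₂) ℤ.* + p                   ∎))
      where
      open ≡-Reasoning
      open ℤSolver

    *-homo : ∀ x y → ι (x ℤ.* y) ≡ ι x *ᶠ ι y
    *-homo x y with p∣ρι x | p∣ρι y
    ... | divides q₁ e₁ | divides q₂ e₂ = ι-cong (x ℤ.* y) (ρ (ι x) ℤ.* ρ (ι y)) (divides (q₁ ℤ.* y ℤ.+ ρ (ι x) ℤ.* q₂) (begin
        (x ℤ.* y) ℤ.- (ρ (ι x) ℤ.* ρ (ι y))
          ≡⟨ solve 4 (λ x y r s → (x :* y) :- (r :* s) := (x :- r) :* y :+ r :* (y :- s)) refl x y (ρ (ι x)) (ρ (ι y)) ⟩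
        (x ℤ.- ρ (ι x)) ℤ.* y ℤ.+ ρ (ι x) ℤ.* (y ℤ.- ρ (ι y))
          ≡⟨ cong₂ (λ a b → a ℤ.* y ℤ.+ ρ (ι x) ℤ.* b) e₁ e₂ ⟩
        q₁ ℤ.* + p ℤ.* y ℤ.+ ρ (ι x) ℤ.* (q₂ ℤ.* + p)
          ≡⟨ solve 5 (λ q₁ p y r q₂ → q₁ :* p :* y :+ r :* (q₂ :* p) := (q₁ :* y :+ r :* q₂) :* p) refl q₁ (+ p) y (ρ (ι x)) q₂ ⟩
        (q₁ ℤ.* y ℤ.+ ρ (ι x) ℤ.* q₂) ℤ.* + p ∎))
      where
      open ≡-Reasoning
      open ℤSolver

    -‿homo : ∀ x → ι (ℤ.- x) ≡ -ᶠ ι x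
    -‿homo x with p∣ρι x
    ... | divides q e = ι-cong (ℤ.- x) (ℤ.- ρ (ι x)) (divides (ℤ.- q) (begin
        ℤ.- x ℤ.- ℤ.- ρ (ι x)   ≡⟨ solve 2 (λ x r → :- x :- (:- r) := :- (x :- r)) refl x (ρ (ι x)) ⟩
        ℤ.- (x ℤ.- ρ (ι x))     ≡⟨ cong ℤ.-_ e ⟩
        ℤ.- (q ℤ.* + p)         ≡⟨ ℤ.neg-distribˡ-* q (+ p) ⟩
        ℤ.- q ℤ.* + p           ∎))
      where
      open ≡-Reasoning
      open ℤSolver

    -- As `ι` is onto, a law need only be checked on reductions of integers, where the homomorphism
    -- properties apply.
    surjective : ∀ {P : 𝔽 → Set} → (∀ z → P (ι z)) → ∀ x → P x
    surjective {P} h x = subst P (ι-ρ x) (h (ρ x))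

    +ᶠ-assoc : Associative _+ᶠ_
    +ᶠ-assoc = surjective λ a → surjective λ b → surjective λ c →
      trans (cong (_+ᶠ ι c) (sym (+-homo a b))) (trans (sym (+-homo (a ℤ.+ b) c)) (trans (cong ι (ℤ.+-assoc a b c))
        (trans (+-homo a (b ℤ.+ c)) (cong (_+ᶠ_ (ι a)) (+-homo b c)))))

    *ᶠ-assoc : Associative _*ᶠ_
    *ᶠ-assoc = surjective λ a → surjective λ b → surjective λ c →
      trans (cong (_*ᶠ ι c) (sym (*-homo a b))) (trans (sym (*-homo (a ℤ.* b) c)) (trans (cong ι (ℤ.*-assoc a b c))
        (trans (*-homo a (b ℤ.* c)) (cong (ι a *ᶠ_) (*-homo b c)))))

    +ᶠ-comm : Commutative _+ᶠ_
    +ᶠ-comm x y = cong ι (ℤ.+-comm (ρ x) (ρ y))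

    *ᶠ-comm : Commutative _*ᶠ_
    *ᶠ-comm x y = cong ι (ℤ.*-comm (ρ x) (ρ y))

    +ᶠ-identityˡ : LeftIdentity 0# _+ᶠ_
    +ᶠ-identityˡ = surjective λ a → trans (sym (+-homo (+ 0) a)) (cong ι (ℤ.+-identityˡ a))

    *ᶠ-identityˡ : LeftIdentity 1# _*ᶠ_
    *ᶠ-identityˡ = surjective λ a → trans (sym (*-homo (+ 1) a)) (cong ι (ℤ.*-identityˡ a))

    +ᶠ-inverseˡ : LeftInverse 0# -ᶠ_ _+ᶠ_
    +ᶠ-inverseˡ = surjective λ a → trans (cong (_+ᶠ ι a) (sym (-‿homo a)))
      (trans (sym (+-homo (ℤ.- a) a)) (cong ι (ℤ.+-inverseˡ a)))

    *ᶠ-distribˡ-+ : _*ᶠ_ DistributesOverˡ _+ᶠ_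
    *ᶠ-distribˡ-+ = surjective λ a → surjective λ b → surjective λ c →
      trans (cong (ι a *ᶠ_) (sym (+-homo b c))) (trans (sym (*-homo a (b ℤ.+ c))) (trans (cong ι (ℤ.*-distribˡ-+ a b c))
        (trans (+-homo (a ℤ.* b) (a ℤ.* c)) (cong₂ _+ᶠ_ (*-homo a b) (*-homo a c)))))

    isCommutativeRing : IsCommutativeRing _≡_ _+ᶠ_ _*ᶠ_ -ᶠ_ 0# 1#
    isCommutativeRing = record
      { isRing = record
        { +-isAbelianGroup = record
          { isGroup = record
            { isMonoid = record
              { isSemigroup = record
                { isMagma = record { isEquivalence = isEquivalence ; ∙-cong = cong₂ _+ᶠ_ }
                ; assoc = +ᶠ-assoc }
              ; identity = +ᶠ-identityˡ , λ x → trans (+ᶠ-comm x 0#) (+ᶠ-identityˡ x) }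
            ; inverse = +ᶠ-inverseˡ , λ x → trans (+ᶠ-comm x (-ᶠ x)) (+ᶠ-inverseˡ x)
            ; ⁻¹-cong = cong -ᶠ_ }
          ; comm = +ᶠ-comm }
        ; *-cong = cong₂ _*ᶠ_
        ; *-assoc = *ᶠ-assoc
        ; *-identity = *ᶠ-identityˡ , λ x → trans (*ᶠ-comm x 1#) (*ᶠ-identityˡ x)
        ; distrib = *ᶠ-distribˡ-+ , λ x y z → trans (*ᶠ-comm (y +ᶠ z) x)
            (trans (*ᶠ-distribˡ-+ x y z) (cong₂ _+ᶠ_ (*ᶠ-comm x y) (*ᶠ-comm x z))) }
      ; *-comm = *ᶠ-comm }

    ∣⇒≡0 : ∀ x → p ℕ.∣ toℕ x → x ≡ 0#
    ∣⇒≡0 x p∣x = trans (sym (ι-ρ x)) (ι-cong (ρ x) (+ 0) (subst (+ p ∣_) (sym (ℤ.+-identityʳ (ρ x))) (∣ᵤ⇒∣ p∣x)))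

    -- Euclid's lemma for representatives: `p` divides their product, hence one of them.
    *-zero-divisor : ∀ x y → x *ᶠ y ≡ 0# → x ≡ 0# ⊎ y ≡ 0#
    *-zero-divisor x y eq with euclidsLemma (toℕ x) (toℕ y) pr
      (subst (p ℕ.∣_) (ℤ.abs-* (ρ x) (ρ y)) (∣⇒∣ᵤ (ι≡0⇒∣ (ρ x ℤ.* ρ y) eq)))
    ... | inj₁ p∣x = inj₁ (∣⇒≡0 x p∣x)
    ... | inj₂ p∣y = inj₂ (∣⇒≡0 y p∣y)

    -- `1#` generates the additive group. Hence a ratio set that contains 0 and is closed under
    -- adding 1 is the whole field, which `pivot` exploits.
    induction : ∀ {P : 𝔽 → Set} → P 0# → (∀ {x} → P x → P (x +ᶠ 1#)) → ∀ x → P x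
    induction {P} base step x = subst P (ι-ρ x) (go (toℕ x))
      where
      go : ∀ k → P (ι (+ k))
      go zero = base
      go (suc k) = subst P (trans (sym (+-homo (+ k) (+ 1))) (cong (λ m → ι (+ m)) (+-comm k 1))) (step (go k))

    1+1≢0 : 2 < p → 1# +ᶠ 1# ≢ 0#
    1+1≢0 2<p eq = contradiction (ℕ.∣⇒≤ (∣⇒∣ᵤ (ι≡0⇒∣ (+ 2) (trans (+-homo (+ 1) (+ 1)) eq)))) (<⇒≱ 2<p)

    addSq≡ : ∀ a b → addSq p a b ≡ a +ᶠ b *ᶠ b
    -- `addSq p a b` is by definition `ι` of the natural number computed from the representatives.
    addSq≡ a b = trans (cong ι (trans (ℤ.pos-+ (toℕ a) _) (cong (ℤ._+_ (ρ a)) (ℤ.pos-* (toℕ b) (toℕ b)))))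
      (trans (+-homo (ρ a) (ρ b ℤ.* ρ b)) (cong (_+ᶠ b *ᶠ b) (ι-ρ a)))

    ι-0 : ι (+ 0) ≡ 0#
    ι-0 = refl

    ι-1 : ι (+ 1) ≡ 1#
    ι-1 = refl

  almostCommutativeRing : AlmostCommutativeRing _ _
  almostCommutativeRing = fromCommutativeRing (record { isCommutativeRing = isCommutativeRing })

  ι-morphism : ℤ.+-*-rawRing -Raw-AlmostCommutative⟶ almostCommutativeRing
  ι-morphism = record
    { ⟦_⟧ = ι ; +-homo = +-homo ; *-homo = *-homo ; -‿homo = -‿homo ; 0-homo = ι-0 ; 1-homo = ι-1 }

  coefficient-≟ : WeaklyDecidable (Induced-equivalence ι-morphism)
  coefficient-≟ x y with x ℤ.≟ y
  ... | yes eq = just (cong ι eq)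
  ... | no _   = nothing

  module Solver = Algebra.Solver.Ring ℤ.+-*-rawRing almostCommutativeRing ι-morphism coefficient-≟

-- Sum-product expansion

module Collisions {F : Set} (_≟_ : DecidableEquality F) where

  open Cardinality _≟_

  -- Counts unordered pairs of positions with equal values, each at its earlier position.
  collisions : (X → F) → List X → ℕ
  collisions f [] = 0
  collisions f (x ∷ xs) = length (filter (λ y → f y ≟ f x) xs) + collisions f xs

  -- Each element either contributes a new value or collides with a later element.
  length≤card+collisions : ∀ (f : X → F) xs → length xs ≤ card (map f xs) + collisions f xs
  length≤card+collisions f [] = z≤n
  length≤card+collisions f (x ∷ xs) with f x ∈? map f xs
  ... | no fx∉ = ≤-trans (s≤s (length≤card+collisions f xs))
          (+-mono-≤ (card-disjoint {xs = f x ∷ []} {ys = map f xs} (λ where (here eq) → here eq) there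
                      (λ where (here refl) → fx∉)) (m≤n+m _ _))
  ... | yes fx∈ with ∈-map⁻ f fx∈
  ...   | y , y∈ , eq = ≤-trans (s≤s (length≤card+collisions f xs)) (≤-trans (≤-reflexive (sym (+-suc _ _)))
          (+-mono-≤ (card-mono {xs = map f xs} there)
            (+-monoˡ-≤ _ (nonempty (∈-filter⁺ (λ y → f y ≟ f x) y∈ (sym eq))))))
    where
    nonempty : ∀ {zs} → y ∈ zs → 1 ≤ length zs
    nonempty (here _)  = s≤s z≤n
    nonempty (there _) = s≤s z≤n

  -- Double counting: two distinct points collide under at most one index, so all indices together
  -- see at most one collision per unordered pair. The induction charges to the head at most one
  -- collision with each later point.
  sum-collisions-≤ : ∀ {I : Set} (f : I → X → F) {is : List I} {xs : List X} → Unique is → Unique xs →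
    (∀ {i j x y} → x ≢ y → f i x ≡ f i y → f j x ≡ f j y → i ≡ j) →
    2 * sum (map (λ i → collisions (f i) xs) is) ≤ length xs * length xs
  sum-collisions-≤ f {is} {[]} ui [] h = ≤-reflexive (cong (2 *_) (zeros is))
    where
    zeros : ∀ (is : List _) → sum (map (λ i → 0) is) ≡ 0
    zeros [] = refl
    zeros (_ ∷ is) = zeros is
  sum-collisions-≤ {X} {I} f {is} {x ∷ xs} ui (x∉ ∷ u) h = begin
    2 * sum (map (λ i → length (hits i) + collisions (f i) xs) is)
      ≡⟨ cong (2 *_) (sum-+ (length ∘ hits) (λ i → collisions (f i) xs) is) ⟩
    2 * (sum (map (length ∘ hits) is) + s)
      ≤⟨ *-monoʳ-≤ 2 (+-monoˡ-≤ s (≤-trans (≤-reflexive (sym (length-dependentPairs is hits)))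
           (length-inject {R = R} (dependentPairs⁺ ui (λ i → Uniq.filter⁺ (λ y → f i y ≟ f i x) u)) img inj))) ⟩
    2 * (length xs + s)
      ≡⟨ *-distribˡ-+ 2 (length xs) s ⟩
    2 * length xs + 2 * s
      ≤⟨ +-monoʳ-≤ (2 * length xs) (sum-collisions-≤ f ui u h) ⟩
    2 * length xs + length xs * length xs
      ≤⟨ n≤1+n _ ⟩
    1 + (2 * length xs + length xs * length xs)
      ≡⟨ solve 1 (λ l → con 1 :+ (con 2 :* l :+ l :* l) := (con 1 :+ l) :* (con 1 :+ l)) refl (length xs) ⟩
    suc (length xs) * suc (length xs) ∎
    where
    open ≤-Reasoning
    open ℕSolver
    hits : I → List X
    hits i = filter (λ y → f i y ≟ f i x) xs

    s : ℕ
    s = sum (map (λ i → collisions (f i) xs) is)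

    R : I × X → X → Set
    R (i , y) z = y ≡ z × x ≢ y × f i y ≡ f i x

    img : ∀ {q} → q ∈ dependentPairs is hits → ∃ λ z → z ∈ xs × R q z
    img {i , y} q∈ with ∈-filter⁻ (λ y → f i y ≟ f i x) {xs = xs} (proj₂ (∈-dependentPairs⁻ is q∈))
    ... | y∈ , eq = y , y∈ , refl , All.lookup x∉ y∈ , eq

    inj : ∀ {q q' z} → R q z → R q' z → q ≡ q'
    inj {_ , y} (refl , x≢y , e) (refl , _ , e') = cong (_, y) (h x≢y (sym e) (sym e'))

  injective⇒length≤card : ∀ (f : X → F) {xs} → Unique xs →
    (∀ {x y} → x ∈ xs → y ∈ xs → f x ≡ f y → x ≡ y) → length xs ≤ card (map f xs)
  injective⇒length≤card f {xs} u inj = length-inject {R = λ x y → x ∈ xs × y ≡ f x} u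
    (λ x∈ → _ , ∈-elems⁺ (∈-map⁺ f x∈) , x∈ , refl)
    (λ where (x∈ , e) (y∈ , e') → inj x∈ y∈ (trans (sym e) e'))

-- The numerical inequality

abstract

  -- Kept opaque: conversion checking could otherwise unfold 8⁷ * m into 8⁷ summands.
  κ : ℕ
  κ = 8 ^ 7

  κ≡8^7 : κ ≡ 8 ^ 7
  κ≡8^7 = refl

  4≤κ : 4 ≤ κ
  4≤κ = ≤ᵇ⇒≤ 4 κ _

-- From d ≤ 2M²/n, each of the four g is at most 2d²/n² ≤ 8(M/n)⁴, so the product of six of them is
-- at most 8⁶(M/n)²⁴. Together with n² ≤ 4b² and D ≤ (M/n)²⁴ n this gives n² ≤ 8⁷(M/n)⁴⁸ n. In the
-- application M = |A + S|, d = |A - A|, D = |12S - 12S|, b = |B|, and each g counts the translates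
-- covering a dilate.
combine-bounds : ∀ n M d D g₁ g₂ g₃ g₄ b → 1 ≤ n → n ≤ 2 * b → n * d ≤ 2 * (M * M) →
  g₁ * (n * n) ≤ 2 * (d * d) → g₂ * (n * n) ≤ 2 * (d * d) →
  g₃ * (n * n) ≤ 2 * (d * d) → g₄ * (n * n) ≤ 2 * (d * d) →
  b * b ≤ 2 * (((g₃ * g₄) * (g₁ * g₂)) * (g₃ * g₄) * D) →
  (n ^ 12 * n ^ 12) * D ≤ (M ^ 12 * M ^ 12) * n →
  n ^ 49 ≤ κ * M ^ 48
combine-bounds n M d D g₁ g₂ g₃ g₄ b 1≤n n≤2b nd≤ h₁ h₂ h₃ h₄ b²≤ D≤ =
  *-cancelˡ-≤ n {{>-nonZero 1≤n}} (begin
    n * n ^ 49                                   ≡⟨ *-assoc n n (n ^ 48) ⟨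
    (n * n) * n ^ 48                             ≡⟨ cong (n * n *_) (power n) ⟨
    (n * n) * (sixth (n ^ 4) * (n ^ 12 * n ^ 12)) ≤⟨ *-monoˡ-≤ (sixth (n ^ 4) * (n ^ 12 * n ^ 12)) n²≤ ⟩
    (8 * (L * D)) * (sixth (n ^ 4) * (n ^ 12 * n ^ 12)) ≡⟨ regroup L D (sixth (n ^ 4)) (n ^ 12 * n ^ 12) ⟩
    8 * ((L * sixth (n ^ 4)) * ((n ^ 12 * n ^ 12) * D)) ≤⟨ *-monoʳ-≤ 8 (*-mono-≤ L≤ D≤) ⟩
    8 * (sixth (8 * M ^ 4) * ((M ^ 12 * M ^ 12) * n)) ≡⟨ collect 8 (M ^ 4) (M ^ 12 * M ^ 12) n ⟩
    n * (8 ^ 7 * (sixth (M ^ 4) * (M ^ 12 * M ^ 12))) ≡⟨ cong₂ (λ c k → n * (c * k)) (sym κ≡8^7) (power M) ⟩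
    n * (κ * M ^ 48)                             ∎)
  where
  open ≤-Reasoning
  open ℕSolver
  L : ℕ
  L = ((g₃ * g₄) * (g₁ * g₂)) * (g₃ * g₄)

  -- The sixth power, bracketed like the six factors of `L`.
  sixth : ℕ → ℕ
  sixth k = ((k * k) * (k * k)) * (k * k)

  power : ∀ m → sixth (m ^ 4) * (m ^ 12 * m ^ 12) ≡ m ^ 48
  power m = trans (cong₂ _*_ (trans (cong₂ _*_ (trans (cong₂ _*_ eight eight) (sym (^-distribˡ-+-* m 8 8))) eight)
                                    (sym (^-distribˡ-+-* m 16 8)))
                             (sym (^-distribˡ-+-* m 12 12)))
                  (sym (^-distribˡ-+-* m 24 24))
    where
    eight : m ^ 4 * m ^ 4 ≡ m ^ 8
    eight = sym (^-distribˡ-+-* m 4 4)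

  n²≤ : n * n ≤ 8 * (L * D)
  n²≤ = begin
    n * n                 ≤⟨ *-mono-≤ n≤2b n≤2b ⟩
    (2 * b) * (2 * b)     ≡⟨ [m*n]*[o*p]≡[m*o]*[n*p] 2 b 2 b ⟩
    4 * (b * b)           ≤⟨ *-monoʳ-≤ 4 b²≤ ⟩
    4 * (2 * (L * D))     ≡⟨ *-assoc 4 2 (L * D) ⟨
    8 * (L * D)           ∎

  regroup : ∀ L D N K → (8 * (L * D)) * (N * K) ≡ 8 * ((L * N) * (K * D))
  regroup = solve 4 (λ L D N K → (con 8 :* (L :* D)) :* (N :* K) := con 8 :* ((L :* N) :* (K :* D))) refl

  collect : ∀ e m K n → e * (sixth (e * m) * (K * n)) ≡ n * (e ^ 7 * (sixth m * K))
  collect = solve 4 (λ e m K n →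
    e :* ((((e :* m) :* (e :* m)) :* ((e :* m) :* (e :* m)) :* ((e :* m) :* (e :* m))) :* (K :* n)) :=
    n :* (e :^ 7 :* (((m :* m) :* (m :* m)) :* (m :* m) :* K))) refl

  product-≤ : ∀ {a b N N' E E'} → a * N ≤ E → b * N' ≤ E' → (a * b) * (N * N') ≤ E * E'
  product-≤ {a} {b} {N} {N'} h h' = ≤-trans (≤-reflexive ([m*n]*[o*p]≡[m*o]*[n*p] a b N N')) (*-mono-≤ h h')

  g≤ : ∀ g → g * (n * n) ≤ 2 * (d * d) → g * n ^ 4 ≤ 8 * M ^ 4
  g≤ g h = begin
    g * n ^ 4                      ≡⟨ solve 2 (λ g n → g :* (n :^ 4) := (g :* (n :* n)) :* (n :* n)) refl g n ⟩
    (g * (n * n)) * (n * n)        ≤⟨ *-monoˡ-≤ (n * n) h ⟩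
    (2 * (d * d)) * (n * n)        ≡⟨ solve 2 (λ d n → (con 2 :* (d :* d)) :* (n :* n) := con 2 :* ((n :* d) :* (n :* d))) refl d n ⟩
    2 * ((n * d) * (n * d))        ≤⟨ *-monoʳ-≤ 2 (*-mono-≤ nd≤ nd≤) ⟩
    2 * ((2 * (M * M)) * (2 * (M * M))) ≡⟨ solve 1 (λ m → con 2 :* ((con 2 :* (m :* m)) :* (con 2 :* (m :* m))) := con 8 :* (m :^ 4)) refl M ⟩
    8 * M ^ 4                      ∎

  L≤ : L * sixth (n ^ 4) ≤ sixth (8 * M ^ 4)
  L≤ = product-≤ {(g₃ * g₄) * (g₁ * g₂)} {g₃ * g₄}
         (product-≤ {g₃ * g₄} {g₁ * g₂} (product-≤ {g₃} {g₄} (g≤ g₃ h₃) (g≤ g₄ h₄)) (product-≤ {g₁} {g₂} (g≤ g₁ h₁) (g≤ g₂ h₂)))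
         (product-≤ {g₃} {g₄} (g≤ g₃ h₃) (g≤ g₄ h₄))

-- Ratio sets, dilates and covers

module Expansion (p : ℕ) (pr : Prime p) where

  open PrimeField p pr
  open Cardinality {𝔽} _≟_
  open Sumsets {𝔽} _≟_ (IsCommutativeRing.+-isAbelianGroup isCommutativeRing)
  open Collisions {𝔽} _≟_
  open IsCommutativeRing isCommutativeRing using () renaming (+-identityˡ to +ᶠ-idˡ; zeroʳ to *ᶠ-zeroʳ; zeroˡ to *ᶠ-zeroˡ; -‿inverseʳ to +ᶠ-invʳ; *-identityˡ to *ᶠ-idˡ)
  open Solver

  abstract
    minus≡0⇒≡ : ∀ x y → x - y ≡ 0# → x ≡ y
    minus≡0⇒≡ x y eq = trans (solve 2 (λ x y → x := (x :- y) :+ y) refl x y) (trans (cong (_+ᶠ y) eq) (+ᶠ-idˡ y))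

    minus-self : ∀ {x y} → x ≡ y → x - y ≡ 0#
    minus-self {x} refl = +ᶠ-invʳ x

    *ᶠ-distribˡ-minus : ∀ u x y → u *ᶠ (x - y) ≡ u *ᶠ x - u *ᶠ y
    *ᶠ-distribˡ-minus = solve 3 (λ u x y → u :* (x :- y) := u :* x :- u :* y) refl

    *ᶠ-distribʳ-minus : ∀ u x y → (x - y) *ᶠ u ≡ x *ᶠ u - y *ᶠ u
    *ᶠ-distribʳ-minus = solve 3 (λ u x y → (x :- y) :* u := x :* u :- y :* u) refl

    difference-of-squares : ∀ x y → (y - x) *ᶠ (y +ᶠ x) ≡ y *ᶠ y - x *ᶠ x
    difference-of-squares = solve 2 (λ x y → (y :- x) :* (y :+ x) := y :* y :- x :* x) refl

    minus-neg : ∀ x y → y - (-ᶠ x) ≡ y +ᶠ x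
    minus-neg = solve 2 (λ x y → y :- (:- x) := y :+ x) refl

    *ᶠ-double : ∀ o v → (o +ᶠ o) *ᶠ v ≡ o *ᶠ v +ᶠ o *ᶠ v
    *ᶠ-double = solve 2 (λ o v → (o :+ o) :* v := o :* v :+ o :* v) refl

    *ᶠ-cancelˡ : ∀ u {x y} → u ≢ 0# → u *ᶠ x ≡ u *ᶠ y → x ≡ y
    *ᶠ-cancelˡ u {x} {y} u≢0 eq with *-zero-divisor u (x - y)
      (trans (*ᶠ-distribˡ-minus u x y) (minus-self eq))
    ... | inj₁ u≡0 = contradiction u≡0 u≢0
    ... | inj₂ e   = minus≡0⇒≡ x y e

  square : 𝔽 → 𝔽
  square x = x *ᶠ x

  squares : List 𝔽 → List 𝔽
  squares = map square

  -- Squaring is at most two-to-one: `y² = x²` factors as `(y - x)(y + x) = 0`.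
  length≤2*card-squares : ∀ {A} → Unique A → length A ≤ 2 * card (squares A)
  length≤2*card-squares {A} u = ≤-trans (≤-reflexive (sym (*-identityˡ (length A))))
    (≤-trans (fibre-bound square u 1 2 fibre-≤) (≤-reflexive (*-comm (card (squares A)) 2)))
    where
    roots : ∀ s xs → Unique xs → (∀ {x} → x ∈ xs → square x ≡ s) → length xs ≤ 2
    roots s [] _ _ = z≤n
    roots s (x ∷ xs) u h = unique-⊆⇒length-≤ u sub
      where
      sub : x ∷ xs ⊆ x ∷ (-ᶠ x) ∷ []
      sub {y} y∈ with *-zero-divisor (y - x) (y +ᶠ x)
        (trans (difference-of-squares x y)
               (minus-self (trans (h y∈) (sym (h (here refl))))))
      ... | inj₁ e = here (minus≡0⇒≡ y x e)
      ... | inj₂ e = there (here (minus≡0⇒≡ y (-ᶠ x) (trans (minus-neg x y) e)))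

    fibre-≤ : ∀ s → 1 * length (filter (λ x → square x ≟ s) A) ≤ 2
    fibre-≤ s = ≤-trans (≤-reflexive (*-identityˡ _)) (roots s _ (Uniq.filter⁺ (λ x → square x ≟ s) u)
      (λ x∈ → proj₂ (∈-filter⁻ (λ x → square x ≟ s) {xs = A} x∈)))

  -- IsRatio B is the set (B - B) / (B - B).
  IsRatio : List 𝔽 → 𝔽 → Set
  IsRatio B ξ = Any (λ where ((c , c') , (d , d')) → c ≢ c' × ξ *ᶠ (c - c') ≡ d - d')
    (cartesianProduct (cartesianProduct B B) (cartesianProduct B B))

  isRatio? : ∀ B → Decidable (IsRatio B)
  isRatio? B ξ = any? (λ where ((c , c') , (d , d')) → ¬? (c ≟ c') ×-dec (ξ *ᶠ (c - c') ≟ d - d')) _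

  isRatio⁺ : ∀ {B ξ c c' d d'} → c ∈ B → c' ∈ B → d ∈ B → d' ∈ B → c ≢ c' → ξ *ᶠ (c - c') ≡ d - d' → IsRatio B ξ
  isRatio⁺ c∈ c'∈ d∈ d'∈ c≢c' eq =
    lose (∈-cartesianProduct⁺ (∈-cartesianProduct⁺ c∈ c'∈) (∈-cartesianProduct⁺ d∈ d'∈)) (c≢c' , eq)

  RatioWitness : List 𝔽 → 𝔽 → Set
  RatioWitness B ξ = ∃ λ c → ∃ λ c' → ∃ λ d → ∃ λ d' →
    (c ∈ B × c' ∈ B × d ∈ B × d' ∈ B) × c ≢ c' × ξ *ᶠ (c - c') ≡ d - d'

  isRatio⁻ : ∀ {B ξ} → IsRatio B ξ → RatioWitness B ξ
  isRatio⁻ {B} r with find r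
  ... | ((c , c') , (d , d')) , q∈ , c≢c' , eq with ∈-cartesianProduct⁻ (cartesianProduct B B) (cartesianProduct B B) q∈
  ...   | cc∈ , dd∈ with ∈-cartesianProduct⁻ B B cc∈ | ∈-cartesianProduct⁻ B B dd∈
  ...     | c∈ , c'∈ | d∈ , d'∈ = c , c' , d , d' , (c∈ , c'∈ , d∈ , d'∈) , c≢c' , eq

  line : 𝔽 → 𝔽 × 𝔽 → 𝔽
  line η (c , d) = c +ᶠ η *ᶠ d

  abstract
    -- A collision between points with different second coordinates exhibits `η` as a ratio of
    -- differences; this gives injectivity off the ratio set and uniqueness of the colliding slope.
    line-collision : ∀ η c d c' d' → line η (c , d) ≡ line η (c' , d') → η *ᶠ (d - d') ≡ c' - c
    line-collision η c d c' d' eq = minus≡0⇒≡ _ _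
      (trans (cong (_- (c' - c)) (*ᶠ-distribˡ-minus η d d'))
      (trans (solve 4 (λ m m' c c' → (m :- m') :- (c' :- c) := (c :+ m) :- (c' :+ m')) refl (η *ᶠ d) (η *ᶠ d') c c')
        (minus-self eq)))

    line-injective-on-rows : ∀ η c c' d → line η (c , d) ≡ line η (c' , d) → c ≡ c'
    line-injective-on-rows η c c' d eq = sym (minus≡0⇒≡ c' c
      (trans (sym (line-collision η c d c' d eq)) (trans (cong (η *ᶠ_) (minus-self refl)) (*ᶠ-zeroʳ η))))

  -- By `line-collision`, a collision with `d ≢ d'` would make `η` a ratio; if `d ≡ d'`, the points
  -- agree.
  notRatio⇒large : ∀ {B η} → Unique B → ¬ IsRatio B η →
    length B * length B ≤ card (map (line η) (cartesianProduct B B))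
  notRatio⇒large {B} {η} u ¬r = subst (_≤ card (map (line η) (cartesianProduct B B)))
    (length-cartesianProductWith _,_ B B)
    (injective⇒length≤card (line η) (Uniq.cartesianProduct⁺ u u) inj)
    where
    inj : ∀ {q q'} → q ∈ cartesianProduct B B → q' ∈ cartesianProduct B B → line η q ≡ line η q' → q ≡ q'
    inj {c , d} {c' , d'} q∈ q'∈ eq with ∈-cartesianProduct⁻ B B q∈ | ∈-cartesianProduct⁻ B B q'∈ | d ≟ d'
    ... | _ | _ | yes refl = cong (_, d) (line-injective-on-rows η c c' d eq)
    ... | c∈ , d∈ | c'∈ , d'∈ | no d≢d' =
          contradiction (isRatio⁺ d∈ d'∈ c'∈ c∈ d≢d' (line-collision η c d c' d' eq)) ¬r

  -- Two distinct points of B × B collide under at most one of the p maps line η.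
  exists-large-line : ∀ {B} → Unique B → length B * length B ≤ p →
    ∃ λ η → length B * length B ≤ 2 * card (map (line η) (cartesianProduct B B))
  exists-large-line {B} u small = let η , _ , h = average-≤ (λ η → 2 * collisions (line η) Q) N (∈-allFin 0#) total in
    η , +-cancelʳ-≤ N _ _ (begin
      N + N                              ≡⟨ cong (N +_) (+-identityʳ N) ⟨
      2 * N                              ≡⟨ cong (2 *_) (length-cartesianProductWith _,_ B B) ⟨
      2 * length Q                       ≤⟨ *-monoʳ-≤ 2 (length≤card+collisions (line η) Q) ⟩
      2 * (card (map (line η) Q) + collisions (line η) Q) ≡⟨ *-distribˡ-+ 2 (card (map (line η) Q)) _ ⟩
      2 * card (map (line η) Q) + 2 * collisions (line η) Q ≤⟨ +-monoʳ-≤ (2 * card (map (line η) Q)) h ⟩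
      2 * card (map (line η) Q) + N      ∎)
    where
    open ≤-Reasoning
    Q : List (𝔽 × 𝔽)
    Q = cartesianProduct B B
    N : ℕ
    N = length B * length B

    slope-unique : ∀ {η θ q q'} → q ≢ q' → line η q ≡ line η q' → line θ q ≡ line θ q' → η ≡ θ
    slope-unique {η} {θ} {c , d} {c' , d'} q≢q' e e' with *-zero-divisor (η - θ) (d - d')
      (trans (*ᶠ-distribʳ-minus (d - d') η θ)
             (minus-self (trans (line-collision η c d c' d' e) (sym (line-collision θ c d c' d' e')))))
    ... | inj₁ z = minus≡0⇒≡ η θ z
    ... | inj₂ z with minus≡0⇒≡ d d' z
    ...   | refl = contradiction (cong (_, d) (line-injective-on-rows η c c' d e)) q≢q'

    total : sum (map (λ η → 2 * collisions (line η) Q) (allFin p)) ≤ length (allFin p) * N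
    total = begin
      sum (map (λ η → 2 * collisions (line η) Q) (allFin p)) ≡⟨ sum-*ˡ 2 (λ η → collisions (line η) Q) (allFin p) ⟩
      2 * sum (map (λ η → collisions (line η) Q) (allFin p))
        ≤⟨ sum-collisions-≤ line (Uniq.allFin⁺ p) (Uniq.cartesianProduct⁺ u u) slope-unique ⟩
      length Q * length Q      ≡⟨ cong₂ _*_ (length-cartesianProductWith _,_ B B) (length-cartesianProductWith _,_ B B) ⟩
      -- Since |B|² ≤ p, the average over the slopes of twice the collisions is at most `N`.
      N * N                    ≤⟨ *-monoˡ-≤ N small ⟩
      p * N                    ≡⟨ cong (_* N) (length-tabulate {n = p} id) ⟨
      length (allFin p) * N    ∎

  -- The ratio set contains 0 = (b - b)/(b - b'). If it is not closed under adding 1, it is left at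
  -- some `ξ + 1`, where the line is injective. If it is closed, it is the whole field, and
  -- `ξ = η - 1` is a ratio for the slope `η` of `exists-large-line`.
  pivot : ∀ {B b b'} → Unique B → b ∈ B → b' ∈ B → b ≢ b' → length B * length B ≤ p →
    ∃ λ ξ → IsRatio B ξ × length B * length B ≤ 2 * card (map (line (ξ +ᶠ 1#)) (cartesianProduct B B))
  pivot {B} {b} {b'} u b∈ b'∈ b≢b' small with anyFin? (λ ξ → isRatio? B ξ ×-dec ¬? (isRatio? B (ξ +ᶠ 1#)))
  ... | yes (ξ , r , ¬r) = ξ , r , ≤-trans (notRatio⇒large u ¬r) (m≤m+n _ _)
  ... | no none = let η , large = exists-large-line u small in
      η - 1# , all-ratios (η - 1#) ,
      subst (λ θ → length B * length B ≤ 2 * card (map (line θ) (cartesianProduct B B)))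
        (solve 2 (λ η o → η := (η :- o) :+ o) refl η 1#) large
    where
    step : ∀ {ξ} → IsRatio B ξ → IsRatio B (ξ +ᶠ 1#)
    step {ξ} r with isRatio? B (ξ +ᶠ 1#)
    ... | yes r' = r'
    ... | no ¬r' = contradiction (ξ , r , ¬r') none

    all-ratios : ∀ ξ → IsRatio B ξ
    all-ratios = induction {IsRatio B} (isRatio⁺ b∈ b'∈ b∈ b∈ b≢b' (trans (*ᶠ-zeroˡ _) (sym (minus-self refl)))) step

  module _ (S : List 𝔽) where

    -- The values of `f` on `I` lie in at most `length G` translates of kS - kS. Indexing by `I`
    -- lets covers of several functions of the same point be added.
    Covers : {J : Set} → ℕ → List 𝔽 → List J → (J → 𝔽) → Set
    Covers k G I f = ∀ {i} → i ∈ I → ∃ λ g → g ∈ G × ∃ λ P → P ∈ k ⊗ S × ∃ λ Q → Q ∈ k ⊗ S × f i ≡ g +ᶠ (P - Q)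

    covers-+ : ∀ {J k l G H} {I : List J} {f h} → Covers k G I f → Covers l H I h →
      Covers (k + l) (G ⊕ H) I (λ i → f i +ᶠ h i)
    covers-+ {k = k} cf ch i∈ with cf i∈ | ch i∈
    ... | g , g∈ , P , P∈ , Q , Q∈ , e | g' , g'∈ , P' , P'∈ , Q' , Q'∈ , e' =
      _ , ∈-⊕⁺ g∈ g'∈ , _ , ∈-⊗-+ k P∈ P'∈ , _ , ∈-⊗-+ k Q∈ Q'∈ , trans (cong₂ _+ᶠ_ e e')
        (trans (solve 4 (λ g r g' r' → (g :+ r) :+ (g' :+ r') := (g :+ g') :+ (r :+ r')) refl g (P - Q) g' (P' - Q'))
          (cong ((g +ᶠ g') +ᶠ_) (solve 4 (λ P Q P' Q' → (P :- Q) :+ (P' :- Q') := (P :+ P') :- (Q :+ Q')) refl P Q P' Q')))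

    -- The set lS - lS is symmetric, so differences cost no more than sums: `P'` and `Q'` change
    -- sides.
    covers-- : ∀ {J k l G H} {I : List J} {f h} → Covers k G I f → Covers l H I h →
      Covers (k + l) (G ⊖ H) I (λ i → f i - h i)
    covers-- {k = k} cf ch i∈ with cf i∈ | ch i∈
    ... | g , g∈ , P , P∈ , Q , Q∈ , e | g' , g'∈ , P' , P'∈ , Q' , Q'∈ , e' =
      _ , ∈-⊖⁺ g∈ g'∈ , _ , ∈-⊗-+ k P∈ Q'∈ , _ , ∈-⊗-+ k Q∈ P'∈ , trans (cong₂ _-_ e e')
        (trans (solve 4 (λ g r g' r' → (g :+ r) :- (g' :+ r') := (g :- g') :+ (r :- r')) refl g (P - Q) g' (P' - Q'))
          (cong ((g - g') +ᶠ_) (solve 4 (λ P Q P' Q' → (P :- Q) :- (P' :- Q') := (P :+ Q') :- (Q :+ P')) refl P Q P' Q')))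

    card-covered-≤ : ∀ {J k G} {I : List J} {f} → Covers k G I f →
      card (map f I) ≤ length G * card ((k ⊗ S) ⊖ (k ⊗ S))
    card-covered-≤ {k = k} {G} {I} {f} cov = ≤-trans (card-mono sub) (card-⊕-≤ G ((k ⊗ S) ⊖ (k ⊗ S)))
      where
      sub : map f I ⊆ G ⊕ ((k ⊗ S) ⊖ (k ⊗ S))
      sub q with ∈-map⁻ f q
      ... | i , i∈ , refl with cov i∈
      ...   | g , g∈ , P , P∈ , Q , Q∈ , e = subst (_∈ G ⊕ ((k ⊗ S) ⊖ (k ⊗ S))) (sym e) (∈-⊕⁺ g∈ (∈-⊖⁺ P∈ Q∈))

  -- The doubling comes from `a² - (a - x)² = 2xa - x²` with `x = b - a₀`.
  dilate : 𝔽 → 𝔽 → 𝔽 → 𝔽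
  dilate a₀ b c = ((b - a₀) +ᶠ (b - a₀)) *ᶠ c

  -- With denominators cleared, the number of translates is at most 2(|A - A| / |A|)².
  DilateCover : List 𝔽 → 𝔽 → 𝔽 → Set
  DilateCover A a₀ b = ∃ λ G → length G * (length A * length A) ≤ 2 * (card (A ⊖ A) * card (A ⊖ A)) ×
    Covers (squares A) 2 G A (dilate a₀ b)

  -- For y, z ∈ A ∩ (A + x), 2x (y - z) = (y² + (z - x)²) - ((y - x)² + z²).
  dilate-cover : ∀ {A a₀ b} → Unique A → a₀ ∈ A → b ∈ popularFrom A a₀ → DilateCover A a₀ b
  dilate-cover {A} {a₀} {b} u a₀∈ b∈P with ∈-filter⁻ (λ b → popular? A (b - a₀)) {xs = A} b∈P
  -- `b` itself lies in the overlap because `b - (b - a₀) = a₀`; `covering` needs such a point.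
  ... | b∈ , pop with covering A (overlapOf A (b - a₀))
          (∈-filter⁺ (λ a → (a - (b - a₀)) ∈? A) b∈ (subst (_∈ A) (sym (minus-minus b a₀)) a₀∈))
  ...   | T , T⊆ , T≤ , cov = map ((x +ᶠ x) *ᶠ_) T , bound , covers
    where
    open ≤-Reasoning
    x : 𝔽
    x = b - a₀
    S : List 𝔽
    S = squares A
    d : ℕ
    d = card (A ⊖ A)
    V⊆ : overlapOf A x ⊆ A
    V⊆ q = proj₁ (∈-filter⁻ (λ a → (a - x) ∈? A) {xs = A} q)

    bound : length (map ((x +ᶠ x) *ᶠ_) T) * (length A * length A) ≤ 2 * (d * d)
    bound = begin
      length (map ((x +ᶠ x) *ᶠ_) T) * (length A * length A) ≡⟨ cong (_* (length A * length A)) (length-map ((x +ᶠ x) *ᶠ_) T) ⟩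
      -- Popularity gives n² ≤ 2d|V| for the overlap V, and the choice of `T` gives |T||V| ≤ |T - V|
      -- ≤ |A - A| = d.
      length T * (length A * length A)                   ≤⟨ *-monoʳ-≤ (length T) pop ⟩
      length T * (2 * d * length (overlapOf A x))        ≡⟨ rearrange (length T) d (length (overlapOf A x)) ⟩
      2 * (d * (length T * length (overlapOf A x)))
        ≡⟨ cong (λ v → 2 * (d * (length T * v))) (card-unique (Uniq.filter⁺ (λ a → (a - x) ∈? A) u)) ⟨
      2 * (d * (length T * card (overlapOf A x)))        ≤⟨ *-monoʳ-≤ 2 (*-monoʳ-≤ d (≤-trans T≤ (card-mono (⊖-mono T⊆ V⊆)))) ⟩
      2 * (d * d)                                        ∎
      where
      rearrange : ∀ t d v → t * (2 * d * v) ≡ 2 * (d * (t * v))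
      rearrange = ℕSolver.solve 3 (λ t d v → t ℕSolver.:* (ℕSolver.con 2 ℕSolver.:* d ℕSolver.:* v) ℕSolver.:=
        ℕSolver.con 2 ℕSolver.:* (d ℕSolver.:* (t ℕSolver.:* v))) refl

    square∈ : ∀ {a} → a ∈ A → square a ∈ 1 ⊗ S
    square∈ a∈ = ∈-1⊗ (∈-map⁺ square a∈)

    covers : Covers S 2 (map ((x +ᶠ x) *ᶠ_) T) A (λ c → (x +ᶠ x) *ᶠ c)
    covers c∈ with cov c∈
    ... | t , t∈ , y , y∈ , z , z∈ , refl with ∈-filter⁻ (λ a → (a - x) ∈? A) {xs = A} y∈ | ∈-filter⁻ (λ a → (a - x) ∈? A) {xs = A} z∈
    ...   | y∈A , y-x∈A | z∈A , z-x∈A =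
      _ , ∈-map⁺ ((x +ᶠ x) *ᶠ_) t∈ , _ , ∈-⊗-+ 1 {S = S} (square∈ y∈A) (square∈ z-x∈A) , _ , ∈-⊗-+ 1 {S = S} (square∈ y-x∈A) (square∈ z∈A) ,
      solve 4 (λ x t y z → (x :+ x) :* (t :+ (y :- z)) := (x :+ x) :* t :+
        ((y :* y :+ (z :- x) :* (z :- x)) :- ((y :- x) :* (y :- x) :+ z :* z))) refl x t y z

  -- Ruzsa's triangle inequality is applied through `S = A²`, so that |A + S| appears; |S| ≥ |A| / 2
  -- costs the factor 2.
  card-⊖-≤ : ∀ {A} → Unique A → length A * card (A ⊖ A) ≤ 2 * (card (A ⊕ squares A) * card (A ⊕ squares A))
  card-⊖-≤ {A} u = begin
    length A * card (A ⊖ A)          ≤⟨ *-monoˡ-≤ (card (A ⊖ A)) (length≤2*card-squares u) ⟩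
    2 * card S * card (A ⊖ A)        ≡⟨ *-assoc 2 (card S) (card (A ⊖ A)) ⟩
    2 * (card S * card (A ⊖ A))      ≤⟨ *-monoʳ-≤ 2 (ruzsa-triangle S A A) ⟩
    2 * (card (S ⊕ A) * card (S ⊕ A)) ≤⟨ *-monoʳ-≤ 2 (*-mono-≤ (card-mono (⊕-comm-⊆ S A)) (card-mono (⊕-comm-⊆ S A))) ⟩
    2 * (card (A ⊕ S) * card (A ⊕ S)) ∎
    where
    open ≤-Reasoning
    S : List 𝔽
    S = squares A

  -- Multiplication by 2(b₃ - b₄), nonzero as p > 2, turns `c + (ξ + 1)d` into 2(b₃ - b₄)c + 2(b₁ -
  -- b₂)d + 2(b₃ - b₄)d. Writing each difference through `a₀` gives six signed dilates, each covered
  -- by translates of 2S - 2S, so the sum is covered by translates of 12S - 12S.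
  card-line-≤ : ∀ A S {B a₀ b₁ b₂ b₃ b₄ ξ G₁ G₂ G₃ G₄} → 2 < p → B ⊆ A → b₃ ≢ b₄ → ξ *ᶠ (b₃ - b₄) ≡ b₁ - b₂ →
    Covers S 2 G₁ A (dilate a₀ b₁) → Covers S 2 G₂ A (dilate a₀ b₂) →
    Covers S 2 G₃ A (dilate a₀ b₃) → Covers S 2 G₄ A (dilate a₀ b₄) →
    card (map (line (ξ +ᶠ 1#)) (cartesianProduct B B)) ≤
      ((length G₃ * length G₄) * (length G₁ * length G₂)) * (length G₃ * length G₄) * card ((12 ⊗ S) ⊖ (12 ⊗ S))
  card-line-≤ A S {B} {a₀} {b₁} {b₂} {b₃} {b₄} {ξ} {G₁} {G₂} {G₃} {G₄} 2<p B⊆A b₃≢b₄ ratio c₁ c₂ c₃ c₄ =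
    ≤-trans (card-map-≤ (line (ξ +ᶠ 1#)) w Q w-reflects)
      (≤-trans (card-covered-≤ S {k = 12} {G} {Q} {w} w-covered)
        (≤-reflexive (cong (_* card ((12 ⊗ S) ⊖ (12 ⊗ S))) length-G)))
    where
    Q : List (𝔽 × 𝔽)
    Q = cartesianProduct B B

    w : 𝔽 × 𝔽 → 𝔽
    w (c , d) = ((dilate a₀ b₃ c - dilate a₀ b₄ c) +ᶠ (dilate a₀ b₁ d - dilate a₀ b₂ d)) +ᶠ (dilate a₀ b₃ d - dilate a₀ b₄ d)

    w≡ : ∀ q → w q ≡ ((b₃ - b₄) +ᶠ (b₃ - b₄)) *ᶠ line (ξ +ᶠ 1#) q
    w≡ (c , d) = trans (cong₂ _+ᶠ_ (cong₂ _+ᶠ_ (dilate-minus b₃ b₄ c) (trans (dilate-minus b₁ b₂ d)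
        (cong (λ e → (e +ᶠ e) *ᶠ d) (sym ratio)))) (dilate-minus b₃ b₄ d))
      -- The solver treats `1#` as a variable, so the last `d` is first written as `1# *ᶠ d`.
      (trans (cong (λ e → ((v +ᶠ v) *ᶠ c +ᶠ (ξ *ᶠ v +ᶠ ξ *ᶠ v) *ᶠ d) +ᶠ (v +ᶠ v) *ᶠ e) (sym (*ᶠ-idˡ d)))
        (solve 5 (λ v ξ c d o → ((v :+ v) :* c :+ (ξ :* v :+ ξ :* v) :* d) :+ (v :+ v) :* (o :* d) :=
          (v :+ v) :* (c :+ (ξ :+ o) :* d)) refl v ξ c d 1#))
      where
      v : 𝔽
      v = b₃ - b₄
      dilate-minus : ∀ b b' c → dilate a₀ b c - dilate a₀ b' c ≡ ((b - b') +ᶠ (b - b')) *ᶠ c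
      dilate-minus b b' c = solve 4 (λ a b b' c → ((b :- a) :+ (b :- a)) :* c :- ((b' :- a) :+ (b' :- a)) :* c :=
        ((b :- b') :+ (b :- b')) :* c) refl a₀ b b' c

    scale≢0 : (b₃ - b₄) +ᶠ (b₃ - b₄) ≢ 0#
    scale≢0 eq with *-zero-divisor (1# +ᶠ 1#) (b₃ - b₄) (trans (*ᶠ-double 1# (b₃ - b₄))
      (trans (cong₂ _+ᶠ_ (*ᶠ-idˡ _) (*ᶠ-idˡ _)) eq))
    ... | inj₁ e = 1+1≢0 2<p e
    ... | inj₂ e = b₃≢b₄ (minus≡0⇒≡ b₃ b₄ e)

    w-reflects : ∀ {q q'} → w q ≡ w q' → line (ξ +ᶠ 1#) q ≡ line (ξ +ᶠ 1#) q'
    w-reflects {q} {q'} eq = *ᶠ-cancelˡ _ scale≢0 (trans (sym (w≡ q)) (trans eq (w≡ q')))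

    G : List 𝔽
    G = ((G₃ ⊖ G₄) ⊕ (G₁ ⊖ G₂)) ⊕ (G₃ ⊖ G₄)

    length-G : length G ≡ ((length G₃ * length G₄) * (length G₁ * length G₂)) * (length G₃ * length G₄)
    length-G = trans (length-cartesianProductWith _+ᶠ_ ((G₃ ⊖ G₄) ⊕ (G₁ ⊖ G₂)) (G₃ ⊖ G₄)) (cong₂ _*_
      (trans (length-cartesianProductWith _+ᶠ_ (G₃ ⊖ G₄) (G₁ ⊖ G₂))
        (cong₂ _*_ (length-cartesianProductWith _-_ G₃ G₄) (length-cartesianProductWith _-_ G₁ G₂)))
      (length-cartesianProductWith _-_ G₃ G₄))

    first : ∀ {q} → q ∈ Q → proj₁ q ∈ A
    first q∈ = B⊆A (proj₁ (∈-cartesianProduct⁻ B B q∈))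
    second : ∀ {q} → q ∈ Q → proj₂ q ∈ A
    second q∈ = B⊆A (proj₂ (∈-cartesianProduct⁻ B B q∈))

    w-covered : Covers S 12 G Q w
    w-covered = covers-+ S {k = 8} {I = Q}
      (covers-+ S {k = 4} {I = Q} (covers-- S {k = 2} {I = Q} (c₃ ∘ first) (c₄ ∘ first))
                                  (covers-- S {k = 2} {I = Q} (c₁ ∘ second) (c₂ ∘ second)))
      (covers-- S {k = 2} {I = Q} (c₃ ∘ second) (c₄ ∘ second))

  -- Four elements ensure that p ≥ 16 exceeds 2 and that the popular set, having at least half of
  -- them, contains the two distinct points required by `pivot`.
  expansion : ∀ {a} A → a ∈ A → Unique A → 4 ≤ length A → length A * length A ≤ p →
    length A ^ 49 ≤ κ * card (A ⊕ squares A) ^ 48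
  expansion A a∈ u 4≤n n²≤p = from-popular (exists-popularFrom u a∈)
    where
    Goal : Set
    Goal = length A ^ 49 ≤ κ * card (A ⊕ squares A) ^ 48

    2<p : 2 < p
    2<p = ≤-trans (s≤s (s≤s (s≤s z≤n))) (≤-trans (*-mono-≤ 4≤n 4≤n) n²≤p)

    two-points : ∀ (B : List 𝔽) → Unique B → 2 ≤ length B → ∃ λ b → ∃ λ b' → b ∈ B × b' ∈ B × b ≢ b'
    two-points (b ∷ b' ∷ _) ((b≢b' ∷ _) ∷ _) _ = b , b' , here refl , there (here refl) , b≢b'
    two-points (_ ∷ []) _ (s≤s ())

    difference-bound : (length A ^ 12 * length A ^ 12) * card ((12 ⊗ squares A) ⊖ (12 ⊗ squares A)) ≤
      (card (A ⊕ squares A) ^ 12 * card (A ⊕ squares A) ^ 12) * length A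
    difference-bound = subst (λ m → (m ^ 12 * m ^ 12) * card ((12 ⊗ squares A) ⊖ (12 ⊗ squares A)) ≤ (card (A ⊕ squares A) ^ 12 * card (A ⊕ squares A) ^ 12) * m)
      (card-unique u) (plünnecke A (squares A) 12 a∈)

    module _ (a₀ : 𝔽) (a₀∈ : a₀ ∈ A) (n≤2b : length A ≤ 2 * length (popularFrom A a₀)) where

      B : List 𝔽
      B = popularFrom A a₀

      B-unique : Unique B
      B-unique = Uniq.filter⁺ (λ b → popular? A (b - a₀)) u

      B⊆A : B ⊆ A
      B⊆A q = proj₁ (∈-filter⁻ (λ b → popular? A (b - a₀)) {xs = A} q)

      B²≤p : length B * length B ≤ p
      B²≤p = ≤-trans (*-mono-≤ B≤A B≤A) n²≤p
        where
        B≤A : length B ≤ length A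
        B≤A = length-filter (λ b → popular? A (b - a₀)) A

      from-covers : ∀ {ξ b₁ b₂ b₃ b₄} → length B * length B ≤ 2 * card (map (line (ξ +ᶠ 1#)) (cartesianProduct B B)) →
        b₃ ≢ b₄ → ξ *ᶠ (b₃ - b₄) ≡ b₁ - b₂ →
        DilateCover A a₀ b₁ → DilateCover A a₀ b₂ → DilateCover A a₀ b₃ → DilateCover A a₀ b₄ → Goal
      from-covers {ξ} {b₁} {b₂} {b₃} {b₄} large b₃≢b₄ ratio (G₁ , g₁ , c₁) (G₂ , g₂ , c₂) (G₃ , g₃ , c₃) (G₄ , g₄ , c₄) =
        combine-bounds (length A) (card (A ⊕ squares A)) (card (A ⊖ A)) (card ((12 ⊗ squares A) ⊖ (12 ⊗ squares A)))
          (length G₁) (length G₂) (length G₃) (length G₄) (length B)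
          (≤-trans (s≤s z≤n) 4≤n) n≤2b (card-⊖-≤ u) g₁ g₂ g₃ g₄
          (≤-trans large (*-monoʳ-≤ 2 (card-line-≤ A (squares A) {B} {a₀} {b₁} {b₂} {b₃} {b₄} {ξ} {G₁} {G₂} {G₃} {G₄}
            2<p B⊆A b₃≢b₄ ratio c₁ c₂ c₃ c₄)))
          difference-bound

      from-ratio : ∀ {ξ} → length B * length B ≤ 2 * card (map (line (ξ +ᶠ 1#)) (cartesianProduct B B)) →
        RatioWitness B ξ → Goal
      from-ratio large (b₃ , b₄ , b₁ , b₂ , (b₃∈ , b₄∈ , b₁∈ , b₂∈) , b₃≢b₄ , ratio) =
        from-covers large b₃≢b₄ ratio
          (dilate-cover u a₀∈ b₁∈) (dilate-cover u a₀∈ b₂∈) (dilate-cover u a₀∈ b₃∈) (dilate-cover u a₀∈ b₄∈)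

      from-pivot : (∃ λ ξ → IsRatio B ξ × length B * length B ≤ 2 * card (map (line (ξ +ᶠ 1#)) (cartesianProduct B B))) → Goal
      from-pivot (ξ , r , large) = from-ratio large (isRatio⁻ r)

      from-points : (∃ λ b → ∃ λ b' → b ∈ B × b' ∈ B × b ≢ b') → Goal
      from-points (b , b' , b∈ , b'∈ , b≢b') = from-pivot (pivot B-unique b∈ b'∈ b≢b' B²≤p)

    from-popular : (∃ λ a₀ → a₀ ∈ A × length A ≤ 2 * length (popularFrom A a₀)) → Goal
    from-popular (a₀ , a₀∈ , n≤2b) = from-points a₀ a₀∈ n≤2b
      (two-points (popularFrom A a₀) (B-unique a₀ a₀∈ n≤2b) (*-cancelˡ-≤ 2 (≤-trans 4≤n n≤2b)))

-- Subsets of `Fin n` as lists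

elements : ∀ {n} → Subset n → List (Fin n)
elements [] = []
elements (inside ∷ A) = zero ∷ map suc (elements A)
elements (outside ∷ A) = map suc (elements A)

length-elements : ∀ {n} (A : Subset n) → length (elements A) ≡ ∣ A ∣
length-elements [] = refl
length-elements (inside ∷ A) = cong suc (trans (length-map suc (elements A)) (length-elements A))
length-elements (outside ∷ A) = trans (length-map suc (elements A)) (length-elements A)

elements-unique : ∀ {n} (A : Subset n) → Unique (elements A)
elements-unique [] = []
elements-unique (inside ∷ A) = All.tabulate zero∉ ∷ Uniq.map⁺ suc-injective (elements-unique A)
  where
  zero∉ : ∀ {x} → x ∈ map suc (elements A) → zero ≢ x
  zero∉ x∈ refl with ∈-map⁻ suc x∈
  ... | ()
elements-unique (outside ∷ A) = Uniq.map⁺ suc-injective (elements-unique A)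

∈-elements⁺ : ∀ {n} {A : Subset n} {x} → x ∈ˢ A → x ∈ elements A
∈-elements⁺ {A = inside ∷ A} here = here refl
∈-elements⁺ {A = inside ∷ A} (there x∈) = there (∈-map⁺ suc (∈-elements⁺ x∈))
∈-elements⁺ {A = outside ∷ A} (there x∈) = ∈-map⁺ suc (∈-elements⁺ x∈)

∈-elements⁻ : ∀ {n} (A : Subset n) {x} → x ∈ elements A → x ∈ˢ A
∈-elements⁻ (inside ∷ A) (here refl) = here
∈-elements⁻ (inside ∷ A) (there x∈) with ∈-map⁻ suc x∈
... | y , y∈ , refl = there (∈-elements⁻ A y∈)
∈-elements⁻ (outside ∷ A) x∈ with ∈-map⁻ suc x∈
... | y , y∈ , refl = there (∈-elements⁻ A y∈)

addSq∈sumSq : ∀ p pr (A : Subset p) {a b} → a ∈ˢ A → b ∈ˢ A → addSq p {{prime⇒nonZero pr}} a b ∈ˢ sumSq p pr A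
addSq∈sumSq p pr A {a} {b} a∈ b∈ = lookup⇒[]= (add a b) (sumSq p pr A)
    (trans (lookup∘tabulate (λ x → ⌊ representable? x ⌋) (add a b))
    (trans (isYes≗does (representable? (add a b))) (dec-true (representable? (add a b)) (a , a∈ , b , b∈ , refl))))
  where
  add : Fin p → Fin p → Fin p
  add = addSq p {{prime⇒nonZero pr}}

  -- The decision procedure of `sumSq` is repeated so that its Boolean value is the entry of the
  -- tabulated vector.
  representable? : ∀ x → Dec (∃ λ a → a ∈ˢ A × ∃ λ b → b ∈ˢ A × x ≡ add a b)
  representable? x = anyFin? (λ a → (a ∈ˢ? A) ×-dec anyFin? (λ b → (b ∈ˢ? A) ×-dec (x ≟ add a b)))

-- Transfer to `sumSq` and the final exponent

enlarge : ∀ K k {a x y} → x ≤ y → a ≤ K * x ^ k → a ≤ K * y ^ k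
enlarge K k x≤y h = ≤-trans h (*-monoʳ-≤ K (^-monoˡ-≤ k x≤y))

module _ (p : ℕ) (pr : Prime p) (A : Subset p) where

  open PrimeField p pr
  open Cardinality {𝔽} _≟_
  open Sumsets {𝔽} _≟_ (IsCommutativeRing.+-isAbelianGroup isCommutativeRing)
  open Expansion p pr using (square; squares; expansion)

  card-sumset≤∣sumSq∣ : card (elements A ⊕ squares (elements A)) ≤ ∣ sumSq p pr A ∣
  card-sumset≤∣sumSq∣ = subst (card (elements A ⊕ squares (elements A)) ≤_) (length-elements (sumSq p pr A)) (⊆⇒card≤length sub)
    where
    sub : elements A ⊕ squares (elements A) ⊆ elements (sumSq p pr A)
    sub q with ∈-cartesianProductWith⁻ _+ᶠ_ (elements A) (squares (elements A)) q
    ... | a , _ , a∈ , s∈ , refl with ∈-map⁻ square s∈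
    ...   | b , b∈ , refl = subst (_∈ elements (sumSq p pr A)) (addSq≡ a b)
              (∈-elements⁺ (addSq∈sumSq p pr A (∈-elements⁻ A a∈) (∈-elements⁻ A b∈)))

  -- The translate of `A` by the square of any one of its elements lies in the sumset.
  ∣A∣≤∣sumSq∣ : ∣ A ∣ ≤ ∣ sumSq p pr A ∣
  ∣A∣≤∣sumSq∣ = subst (_≤ ∣ sumSq p pr A ∣) (length-elements A) (≤-trans (translate (elements A) (elements-unique A)) card-sumset≤∣sumSq∣)
    where
    translate : ∀ as → Unique as → length as ≤ card (as ⊕ map square as)
    translate [] _ = z≤n
    translate as@(a ∷ _) u = ≤-trans (unique⇒length≤card u)
      (≤-trans (card≤card-map as (λ {x} {y} → ∙-cancel (square a) x y)) (card-mono sub))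
      where
      ∙-cancel : ∀ s x y → x +ᶠ s ≡ y +ᶠ s → x ≡ y
      ∙-cancel s x y eq = trans (solve 2 (λ x s → x := (x :+ s) :- s) refl x s)
        (trans (cong (_- s) eq) (solve 2 (λ y s → (y :+ s) :- s := y) refl y s))
        where open Solver
      sub : map (_+ᶠ square a) as ⊆ as ⊕ map square as
      sub q with ∈-map⁻ (_+ᶠ square a) q
      ... | x , x∈ , refl = ∈-⊕⁺ x∈ (here refl)

  ∣A∣^49≤ : 4 ≤ ∣ A ∣ → ∣ A ∣ * ∣ A ∣ ≤ p → ∣ A ∣ ^ 49 ≤ κ * ∣ sumSq p pr A ∣ ^ 48
  ∣A∣^49≤ 4≤ n²≤p = enlarge κ 48 card-sumset≤∣sumSq∣ (transport (length-elements A) 4≤ n²≤p)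
    where
    transport : ∀ {n} → length (elements A) ≡ n → 4 ≤ n → n * n ≤ p →
      n ^ 49 ≤ κ * card (elements A ⊕ squares (elements A)) ^ 48
    transport refl 4≤n = expansion (elements A) (proj₂ (nonempty (elements A) 4≤n)) (elements-unique A) 4≤n
      where
      nonempty : ∀ (as : List 𝔽) → 4 ≤ length as → ∃ λ a → a ∈ as
      nonempty (a ∷ _) _ = a , here refl

-- Multiplying by `n ^ 98 ≤ m ^ 98` adds 98 to both exponents: 49 + 98 = 147 and 48 + 98 = 146.
raise-exponent : ∀ n m K → n ≤ m → n ^ 49 ≤ K * m ^ 48 → n ^ 147 ≤ K * m ^ 146
raise-exponent n m K n≤m h = begin
  n ^ 147                ≡⟨ ^-distribˡ-+-* n 49 98 ⟩
  n ^ 49 * n ^ 98        ≤⟨ *-mono-≤ h (^-monoˡ-≤ 98 n≤m) ⟩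
  K * m ^ 48 * m ^ 98    ≡⟨ *-assoc K (m ^ 48) (m ^ 98) ⟩
  K * (m ^ 48 * m ^ 98)  ≡⟨ cong (K *_) (^-distribˡ-+-* m 48 98) ⟨
  K * m ^ 146            ∎
  where open ≤-Reasoning

unconditional : ∀ n m K → 4 ≤ K → n ≤ m → (4 ≤ n → n ^ 49 ≤ K * m ^ 48) → n ^ 147 ≤ K * m ^ 146
unconditional n m K 4≤K n≤m h = cases (4 ≤? n)
  where
  cases : Dec (4 ≤ n) → n ^ 147 ≤ K * m ^ 146
  cases (yes 4≤n) = raise-exponent n m K n≤m (h 4≤n)
  -- For `n < 4` the constant absorbs one factor: `n * n ^ 146 ≤ K * m ^ 146`.
  cases (no 4≰n)  = *-mono-≤ (≤-trans (<⇒≤ (≰⇒> 4≰n)) 4≤K) (^-monoˡ-≤ 146 n≤m)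

-- Taking 146th powers clears the fractional exponent; `K` is the implied constant c to the power
-- -146.
theorem3p1 : Σ ℕ λ K → NonZero K ×
    ((p : ℕ) (pr : Prime p) (A : Subset p) → ∣ A ∣ ^ 2 ≤ p →
    ∣ A ∣ ^ 147 ≤ K * ∣ sumSq p pr A ∣ ^ 146)
theorem3p1 = κ , >-nonZero (≤-trans (s≤s z≤n) 4≤κ) , bound
  where
  bound : (p : ℕ) (pr : Prime p) (A : Subset p) → ∣ A ∣ ^ 2 ≤ p → ∣ A ∣ ^ 147 ≤ κ * ∣ sumSq p pr A ∣ ^ 146
  bound p pr A n²≤p = unconditional ∣ A ∣ ∣ sumSq p pr A ∣ κ 4≤κ (∣A∣≤∣sumSq∣ p pr A)
    (λ 4≤n → ∣A∣^49≤ p pr A 4≤n (subst (_≤ p) (cong (∣ A ∣ *_) (*-identityʳ ∣ A ∣)) n²≤p))
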